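{- Let $t$ and $k$ be integers with $t\geq k\geq 1$, and let $G$ be a $t$-connected graph of order $n\geq\frac{15t-11k+29}{2}$, where $n\equiv k \pmod 2$. If $$e(G)>\binom{n+k-t-2}{2}+(t-k+2)(t+1),$$ then $G$ is $k$-factor-critical unless $\mathcal{C}_{n+k-1}(G)\cong K_{t}\vee (K_{n+k-2t-1}+(t-k+1)K_{1})$.
   Context: All graphs are finite, simple and undirected. The order of a graph is its number of vertices, and $e(G)$ is the number of edges of $G$; $d_G(v)$ denotes the degree of vertex $v$ in $G$. A connected graph is called $t$-connected if it has more than $t$ vertices and remains connected whenever fewer than $t$ vertices are removed. A graph $G$ is $k$-factor-critical if $G-S$ has a perfect matching for every $S\subseteq V(G)$ with $|S|=k$. For an integer $l\geq 0$, the $l$-closure $\mathcal{C}_{l}(G)$ of $G$ is the graph obtained from $G$ by successively joining pairs of nonadjacent vertices whose degree sum (in the current graph) is at least $l$, until no such pair exists. $K_m$ is the complete graph on $m$ vertices; $G+H$ is the disjoint union of vertex-disjoint graphs $G$ and $H$; $sG$ is the disjoint union of $s$ copies of $G$; the join $G\vee H$ is obtained from $G+H$ by adding all edges between $V(G)$ and $V(H)$. -}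

module Defs where

open import Level using (0ℓ)
open import Data.Nat using (ℕ; zero; suc; _+_; _∸_; _≤_; _<_; _≤?_; z≤n; s≤s)
open import Data.Nat.Properties using (≤-trans; +-mono-≤; m≤n⇒m≤1+n)
open import Data.Nat.Induction using (<-wellFounded)
open import Data.Fin using (Fin)
import Data.Fin as Fin
import Data.Fin.Properties as Fin
open import Data.Fin.Subset using (Subset; _∉_; ∣_∣)
open import Data.List using (List; []; _∷_; length; filter; cartesianProduct; allFin)
open import Data.List.Relation.Unary.Any using (here; there)
import Data.List.Membership.Propositional as List
open import Data.List.Membership.Propositional.Properties using (∈-cartesianProduct⁺; ∈-allFin)
open import Data.Product using (Σ-syntax; ∃; ∃!; _×_; _,_; proj₁; proj₂)
open import Data.Sum using (_⊎_; inj₁; inj₂)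
open import Data.Unit using (⊤; tt)
open import Data.Empty using (⊥)
open import Data.Refinement using (Refinement-syntax; value)
open import Function.Base using (_∘_; id)
open import Function.Bundles using (_↔_; _⇔_; Inverse)
open import Induction.WellFounded using (Acc; acc)
open import Relation.Binary.Core using (Rel)
open import Relation.Binary.Definitions using (Decidable; Symmetric)
open import Relation.Binary.Construct.Closure.ReflexiveTransitive using (Star; ε; _◅_)
open import Relation.Binary.PropositionalEquality using (_≡_; _≢_; refl; sym; trans; ≢-sym)
open import Relation.Nullary using (¬_; Dec; yes; no; contradiction; decidable-stable)
open import Relation.Nullary.Decidable using (¬?; _×-dec_; _⊎-dec_)

-- Finite graphs of order n are elements of Graph (Fin n); other vertex types
-- arise from the operations below.

record Graph (V : Set) : Set₁ where
  field
    Adj    : Rel V 0ℓ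
    Adj?   : Decidable Adj
    symm   : Symmetric Adj
    irrefl : ∀ {v} → ¬ Adj v v

open Graph public

infix 4 _⊆ᴳ_ _≅_

_⊆ᴳ_ : {V : Set} → Graph V → Graph V → Set
G ⊆ᴳ H = ∀ {u v} → Adj G u v → Adj H u v

_≅_ : {V W : Set} → Graph V → Graph W → Set
_≅_ {V} {W} G H =
  Σ[ f ∈ V ↔ W ] (∀ u v → Adj G u v ⇔ Adj H (Inverse.to f u) (Inverse.to f v))

deg : ∀ {n} → Graph (Fin n) → Fin n → ℕ
deg {n} G v = length (filter (Adj? G v) (allFin n))

-- The edge {u , v} is listed once, as the pair with u < v.
edges : ∀ {n} → Graph (Fin n) → List (Fin n × Fin n)
edges {n} G = filter (λ (u , v) → (u Fin.<? v) ×-dec Adj? G u v)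
                     (cartesianProduct (allFin n) (allFin n))

e : ∀ {n} → Graph (Fin n) → ℕ
e G = length (edges G)

-- The proof of v ∉ S is irrelevant, so vertices of G ∖ S are equal as soon as
-- the underlying vertices of G are.
_∖_ : ∀ {n} → Graph (Fin n) → (S : Subset n) → Graph [ v ∈ Fin n ∣ v ∉ S ]
G ∖ S = record
  { Adj    = λ u v → Adj G (value u) (value v)
  ; Adj?   = λ u v → Adj? G (value u) (value v)
  ; symm   = symm G
  ; irrefl = irrefl G
  }

Connected : {V : Set} → Graph V → Set
Connected G = ∀ u v → Star (Adj G) u v

_-Connected : ℕ → ∀ {n} → Graph (Fin n) → Set
(t -Connected) {n} G =
  Connected G × t < n × (∀ (S : Subset n) → ∣ S ∣ < t → Connected (G ∖ S))

-- A set of edges of G, viewed as the spanning subgraph M, that covers every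
-- vertex exactly once.
HasPerfectMatching : {V : Set} → Graph V → Set₁
HasPerfectMatching {V} G =
  Σ[ M ∈ Graph V ] (M ⊆ᴳ G × (∀ v → ∃! _≡_ (Adj M v)))

_-FactorCritical : ℕ → ∀ {n} → Graph (Fin n) → Set₁
(k -FactorCritical) {n} G =
  ∀ (S : Subset n) → ∣ S ∣ ≡ k → HasPerfectMatching (G ∖ S)

K : ∀ m → Graph (Fin m)
K m = record
  { Adj    = _≢_
  ; Adj?   = λ u v → ¬? (u Fin.≟ v)
  ; symm   = ≢-sym
  ; irrefl = λ v≢v → v≢v refl
  }

module _ {V W : Set} (G : Graph V) (H : Graph W) where

  -- X is the adjacency between the two sides: ⊥ for the union, ⊤ for the join.
  private
    combine : (X : Set) → Dec X → Graph (V ⊎ W)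
    combine X X? = record
      { Adj = A ; Adj? = A? ; symm = λ {x} {y} → A-sym x y ; irrefl = λ {x} → A-irr x }
      where
      A : Rel (V ⊎ W) 0ℓ
      A (inj₁ x) (inj₁ y) = Adj G x y
      A (inj₂ x) (inj₂ y) = Adj H x y
      A (inj₁ _) (inj₂ _) = X
      A (inj₂ _) (inj₁ _) = X

      A? : Decidable A
      A? (inj₁ x) (inj₁ y) = Adj? G x y
      A? (inj₂ x) (inj₂ y) = Adj? H x y
      A? (inj₁ _) (inj₂ _) = X?
      A? (inj₂ _) (inj₁ _) = X?

      A-sym : ∀ x y → A x y → A y x
      A-sym (inj₁ _) (inj₁ _) = symm G
      A-sym (inj₂ _) (inj₂ _) = symm H
      A-sym (inj₁ _) (inj₂ _) = id
      A-sym (inj₂ _) (inj₁ _) = id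

      A-irr : ∀ x → ¬ A x x
      A-irr (inj₁ _) = irrefl G
      A-irr (inj₂ _) = irrefl H

  infixr 6 _⊕_ _∨_

  _⊕_ : Graph (V ⊎ W)
  _⊕_ = combine ⊥ (no id)

  _∨_ : Graph (V ⊎ W)
  _∨_ = combine ⊤ (yes tt)

infixr 7 _·_

-- s · G is the disjoint union of s copies of G.
_·_ : {V : Set} (s : ℕ) → Graph V → Graph (Fin s × V)
s · G = record
  { Adj    = λ (i , u) (j , v) → i ≡ j × Adj G u v
  ; Adj?   = λ (i , u) (j , v) → (i Fin.≟ j) ×-dec Adj? G u v
  ; symm   = λ (i≡j , uv) → sym i≡j , symm G uv
  ; irrefl = λ (_ , vv) → irrefl G vv
  }

addEdge : ∀ {n} → Graph (Fin n) → (a b : Fin n) → a ≢ b → Graph (Fin n)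
addEdge G a b a≢b = record
  { Adj    = λ u v → Adj G u v ⊎ (u ≡ a × v ≡ b) ⊎ (u ≡ b × v ≡ a)
  ; Adj?   = λ u v → Adj? G u v ⊎-dec ((u Fin.≟ a) ×-dec (v Fin.≟ b))
                                ⊎-dec ((u Fin.≟ b) ×-dec (v Fin.≟ a))
  ; symm   = λ { (inj₁ uv)              → inj₁ (symm G uv)
               ; (inj₂ (inj₁ (p , q))) → inj₂ (inj₂ (q , p))
               ; (inj₂ (inj₂ (p , q))) → inj₂ (inj₁ (q , p)) }
  ; irrefl = λ { (inj₁ vv)              → irrefl G vv
               ; (inj₂ (inj₁ (p , q))) → a≢b (trans (sym p) q)
               ; (inj₂ (inj₂ (p , q))) → a≢b (trans (sym q) p) }
  }

Joinable : ℕ → ∀ {n} → Graph (Fin n) → Rel (Fin n) 0ℓ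
Joinable l G u v = u ≢ v × ¬ Adj G u v × l ≤ deg G u + deg G v

data Step (l : ℕ) {n : ℕ} (G : Graph (Fin n)) : Graph (Fin n) → Set₁ where
  join : ∀ {u v} (j : Joinable l G u v) → Step l G (addEdge G u v (proj₁ j))

IsClosure : ℕ → ∀ {n} → Rel (Graph (Fin n)) _
IsClosure l G H = Star (Step l) G H × (∀ u v → ¬ Joinable l H u v)

module _ {A : Set} {P Q : A → Set} (P? : ∀ x → Dec (P x)) (Q? : ∀ x → Dec (Q x))
         (P⇒Q : ∀ {x} → P x → Q x) where

  length-filter-mono : ∀ xs → length (filter P? xs) ≤ length (filter Q? xs)
  length-filter-mono [] = z≤n
  length-filter-mono (x ∷ xs) with P? x | Q? x
  ... | yes p | yes q = s≤s (length-filter-mono xs)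
  ... | yes p | no ¬q = contradiction (P⇒Q p) ¬q
  ... | no ¬p | yes q = m≤n⇒m≤1+n (length-filter-mono xs)
  ... | no ¬p | no ¬q = length-filter-mono xs

  length-filter-strict : ∀ {x xs} → x List.∈ xs → ¬ P x → Q x →
                         length (filter P? xs) < length (filter Q? xs)
  length-filter-strict {x} {_ ∷ xs} (here refl) ¬p q with P? x | Q? x
  ... | yes p | _     = contradiction p ¬p
  ... | no _  | no ¬q = contradiction q ¬q
  ... | no _  | yes _ = s≤s (length-filter-mono xs)
  length-filter-strict {xs = y ∷ _} (there x∈) ¬p q with P? y | Q? y
  ... | yes p | yes _ = s≤s (length-filter-strict x∈ ¬p q)
  ... | yes p | no ¬q = contradiction (P⇒Q p) ¬q
  ... | no _  | yes _ = m≤n⇒m≤1+n (length-filter-strict x∈ ¬p q)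
  ... | no _  | no _  = length-filter-strict x∈ ¬p q

deg-mono : ∀ {n} (G H : Graph (Fin n)) → G ⊆ᴳ H → ∀ v → deg G v ≤ deg H v
deg-mono {n} G H G⊆H v = length-filter-mono (Adj? G v) (Adj? H v) G⊆H (allFin n)

-- Every sequence of joins terminates, as each join lowers this number.
nonAdjacentPairs : ∀ {n} → Graph (Fin n) → ℕ
nonAdjacentPairs {n} G =
  length (filter (λ (u , v) → ¬? (Adj? G u v)) (cartesianProduct (allFin n) (allFin n)))

step-decreases : ∀ {l n} {G H : Graph (Fin n)} → Step l G H →
                 nonAdjacentPairs H < nonAdjacentPairs G
step-decreases {G = G} (join {u} {v} j@(u≢v , ¬uv , _)) =
  length-filter-strict
    (λ (x , y) → ¬? (Adj? (addEdge G u v (proj₁ j)) x y)) (λ (x , y) → ¬? (Adj? G x y))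
    (_∘ inj₁) (∈-cartesianProduct⁺ (∈-allFin u) (∈-allFin v))
    (λ ¬uv′ → ¬uv′ (inj₂ (inj₁ (refl , refl)))) ¬uv

closure-exists : ∀ l {n} (G : Graph (Fin n)) → ∃ (IsClosure l G)
closure-exists l G = go G (<-wellFounded _)
  where
  joinable? : ∀ {n} (G : Graph (Fin n)) → Decidable (Joinable l G)
  joinable? G u v = ¬? (u Fin.≟ v) ×-dec ¬? (Adj? G u v) ×-dec (l ≤? deg G u + deg G v)

  go : ∀ {n} (G : Graph (Fin n)) → Acc _<_ (nonAdjacentPairs G) → ∃ (IsClosure l G)
  go G (acc rs) with Fin.any? (λ u → Fin.any? (joinable? G u))
  ... | no ¬j = G , ε , λ u v j → ¬j (u , v , j)
  ... | yes (u , v , j) =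
    let s = join j
        (H , steps , closed) = go (addEdge G u v (proj₁ j)) (rs (step-decreases {l} s))
    in H , s ◅ steps , closed

𝒞 : ℕ → ∀ {n} → Graph (Fin n) → Graph (Fin n)
𝒞 l G = proj₁ (closure-exists l G)

𝒞-isClosure : ∀ l {n} (G : Graph (Fin n)) → IsClosure l G (𝒞 l G)
𝒞-isClosure l G = proj₂ (closure-exists l G)

steps-⊆ : ∀ {l n} {G H : Graph (Fin n)} → Star (Step l) G H → G ⊆ᴳ H
steps-⊆ ε               = id
steps-⊆ (join j ◅ rest) = steps-⊆ rest ∘ inj₁

steps-⊆-closed : ∀ {l n} {G H C : Graph (Fin n)} → Star (Step l) G H → G ⊆ᴳ C →
                 (∀ u v → ¬ Joinable l C u v) → H ⊆ᴳ C
steps-⊆-closed ε G⊆C closed = G⊆C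
steps-⊆-closed {G = G} {C = C} (join {a} {b} (a≢b , _ , l≤) ◅ rest) G⊆C closed =
  steps-⊆-closed {C = C} rest G′⊆C closed
  where
  ab : Adj C a b
  ab = decidable-stable (Adj? C a b) λ ¬ab → closed a b
    (a≢b , ¬ab , ≤-trans l≤ (+-mono-≤ (deg-mono G C G⊆C a) (deg-mono G C G⊆C b)))

  G′⊆C : addEdge G a b a≢b ⊆ᴳ C
  G′⊆C (inj₁ uv)                    = G⊆C uv
  G′⊆C (inj₂ (inj₁ (refl , refl))) = ab
  G′⊆C (inj₂ (inj₂ (refl , refl))) = symm C ab

-- The result does not depend on the order in which pairs are joined.
closure-unique : ∀ {l n} {G H H′ : Graph (Fin n)} → IsClosure l G H → IsClosure l G H′ →
                 H ⊆ᴳ H′ × H′ ⊆ᴳ H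
closure-unique {H = H} {H′} (s , c) (s′ , c′) =
  steps-⊆-closed {C = H′} s (steps-⊆ s′) c′ , steps-⊆-closed {C = H} s′ (steps-⊆ s) c

module Submission where

open import Defs
open import Data.Bool using (Bool; true; false; if_then_else_)
import Data.Bool as Bool
open import Data.Nat using (ℕ; zero; suc; _+_; _*_; _∸_; _≤_; _<_; _≥_; _>_; _≤?_; _%_; _/_;
  z≤n; s≤s)
open import Data.Nat.Combinatorics using (_C_; nC1≡n; nCk+nC[k+1]≡[n+1]C[k+1])
open import Data.Nat.DivMod using (m≡m%n+[m/n]*n; /-monoˡ-≤)
open import Data.Nat.Properties
open import Data.Nat.Tactic.RingSolver using (solve-∀)
open import Data.Fin using (Fin; zero; suc; _↑ˡ_; _↑ʳ_; splitAt)
import Data.Fin as Fin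
import Data.Fin.Properties as Fin
open import Data.Fin.Permutation using (permutation)
open import Data.Fin.Permutation.Components using (transpose)
open import Data.Fin.Subset using (Subset; _∈_; _∉_; _∪_; ⁅_⁆; ∣_∣; inside; outside)
open import Data.Fin.Subset.Properties using (_∈?_; x∈p∪q⁺; x∈p∪q⁻; x∈⁅x⁆; x∈⁅y⁆⇒x≡y)
open import Data.List using (List; []; _∷_; length; filter; cartesianProduct; allFin; map; _++_)
import Data.List as List
import Data.List.Properties as List
open import Data.List.Relation.Unary.Any using (here; there)
import Data.List.Membership.Propositional as List
open import Data.List.Membership.Propositional.Properties using (∈-allFin)
open import Data.Vec using ([]; _∷_; tabulate)
open import Data.Vec.Properties using (lookup∘tabulate; lookup⇒[]=; []=⇒lookup)
open import Data.Empty using (⊥)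
open import Data.Unit using (⊤; tt)
open import Data.Product using (Σ; Σ-syntax; ∃; _×_; _,_; proj₁; proj₂)
open import Data.Sum using (_⊎_; inj₁; inj₂)
import Data.Sum as Sum
open import Data.Sum.Properties using (swap-involutive)
open import Data.Refinement using (Refinement-syntax; value; _,_)
open import Data.Irrelevant using ([_])
open import Function.Base using (_∘_; id; _∋_)
open import Function.Bundles using (_↔_; mk↔ₛ′; Inverse; _⇔_; mk⇔; Equivalence)
open import Relation.Binary.Construct.Closure.ReflexiveTransitive using (Star; ε; _◅_)
import Relation.Binary.Construct.Closure.ReflexiveTransitive as Star
open import Relation.Binary.Definitions using (DecidableEquality)
open import Relation.Binary.PropositionalEquality
  using (_≡_; _≢_; refl; sym; trans; ≢-sym; cong; cong₂; subst; subst₂; module ≡-Reasoning)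
open import Relation.Nullary using (¬_; Dec; yes; no; does; contradiction; decidable-stable;
  recompute)
open import Relation.Nullary.Decidable using (¬?; _×-dec_; _⊎-dec_; dec-true; dec-false)
open import Relation.Unary using (Decidable)
open import Algebra.Properties.Semiring.Sum +-*-semiring
  using (sum; sum-cong-≗; sum-permute; ∑-distrib-+; ∑-comm; *-distribˡ-sum; *-distribʳ-sum)

-- Put l = n + k − 1. If uv is joined in passing to the closure and a perfect
-- matching of G + uv − S uses uv, then some other matching edge xy allows uv, xy
-- to be traded for ux, vy: otherwise each matching edge receives at most two
-- edges from {u, v} and d(u) + d(v) < l. So it suffices to treat the closure H,
-- in which nonadjacent vertices have degree sum at most n + k − 2 and every
-- degree is at least t.
--
-- Let K be a maximal clique of H containing all vertices of degree at least
-- (n + k)/2, and m = |K|. A vertex outside K misses a vertex of K, so its degree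
-- is at most n + k − m − 1; being at least t, this gives n − m ≥ t − k + 1 unless
-- K is everything and H is complete. Since H has many edges, n − m ≤ t − k + 1:
-- for small m because outer degrees are below (n + k)/2, for larger m because
-- they are at most n + k − m − 1. So n − m = t − k + 1, all outer degrees equal t,
-- and a vertex of K with an outer neighbour is joined to every outer vertex. These
-- vertices of K form a separator, hence number at least t, hence are exactly the
-- neighbours of each outer vertex: H is the extremal graph.

private variable
  n : ℕ

-- Counting and connectivity

-- The Iverson bracket. Degrees and cardinalities become sums of these values, so that counting
-- arguments reduce to pointwise inequalities.
⟦_⟧ : {P : Set} → Dec P → ℕ
⟦ d ⟧ = if does d then 1 else 0

⟦⟧-yes : {P : Set} (d : Dec P) → P → ⟦ d ⟧ ≡ 1
⟦⟧-yes d p rewrite dec-true d p = refl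

⟦⟧-no : {P : Set} (d : Dec P) → ¬ P → ⟦ d ⟧ ≡ 0
⟦⟧-no d ¬p rewrite dec-false d ¬p = refl

⟦⟧≤1 : {P : Set} (d : Dec P) → ⟦ d ⟧ ≤ 1
⟦⟧≤1 (yes _) = s≤s z≤n
⟦⟧≤1 (no _) = z≤n

⟦⟧-mono : {P Q : Set} (d : Dec P) (d′ : Dec Q) → (P → Q) → ⟦ d ⟧ ≤ ⟦ d′ ⟧
⟦⟧-mono (no _)  _ _ = z≤n
⟦⟧-mono (yes p) d′ f = ≤-reflexive (sym (⟦⟧-yes d′ (f p)))

⟦⟧-disjoint : {P Q R : Set} (p? : Dec P) (q? : Dec Q) (r? : Dec R) →
              (P → R) → (Q → R) → ¬ (P × Q) → ⟦ p? ⟧ + ⟦ q? ⟧ ≤ ⟦ r? ⟧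
⟦⟧-disjoint (yes p) (yes q) r? f g ¬pq = contradiction (p , q) ¬pq
⟦⟧-disjoint (yes p) (no _)  r? f g ¬pq = ≤-reflexive (sym (⟦⟧-yes r? (f p)))
⟦⟧-disjoint (no _)  q?      r? f g ¬pq = ⟦⟧-mono q? r? g

sum-mono : {f g : Fin n → ℕ} → (∀ i → f i ≤ g i) → sum f ≤ sum g
sum-mono {zero}  f≤g = z≤n
sum-mono {suc n} f≤g = +-mono-≤ (f≤g zero) (sum-mono (f≤g ∘ suc))

sum-const : ∀ n c → sum {n} (λ _ → c) ≡ n * c
sum-const zero    c = refl
sum-const (suc n) c = cong (c +_) (sum-const n c)

sum-+-mono : (f g h : Fin n → ℕ) → (∀ i → f i + g i ≤ h i) → sum f + sum g ≤ sum h
sum-+-mono f g h le = ≤-trans (≤-reflexive (sym (∑-distrib-+ f g))) (sum-mono le)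

length-filter-tabulate : {A : Set} {P : A → Set} (P? : Decidable P) (f : Fin n → A) →
                         length (filter P? (List.tabulate f)) ≡ sum (λ i → ⟦ P? (f i) ⟧)
length-filter-tabulate {zero}  P? f = refl
length-filter-tabulate {suc n} P? f with P? (f zero)
... | yes _ = cong suc (length-filter-tabulate P? (f ∘ suc))
... | no _  = length-filter-tabulate P? (f ∘ suc)

deg-sum : (G : Graph (Fin n)) (v : Fin n) → deg G v ≡ sum (λ u → ⟦ Adj? G v u ⟧)
deg-sum G v = length-filter-tabulate (Adj? G v) id

length-filter-map : {A B : Set} {P : B → Set} (P? : Decidable P) (f : A → B) (xs : List A) →
                    length (filter P? (map f xs)) ≡ length (filter (P? ∘ f) xs)
length-filter-map P? f [] = refl
length-filter-map P? f (x ∷ xs) with P? (f x)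
... | yes _ = cong suc (length-filter-map P? f xs)
... | no _  = length-filter-map P? f xs

length-filter-cartesianProduct :
  ∀ {m n} {A B : Set} {P : A × B → Set} (P? : Decidable P) (f : Fin m → A) (g : Fin n → B) →
  length (filter P? (cartesianProduct (List.tabulate f) (List.tabulate g)))
    ≡ sum (λ i → sum (λ j → ⟦ P? (f i , g j) ⟧))
length-filter-cartesianProduct {zero} P? f g = refl
length-filter-cartesianProduct {suc m} P? f g = begin
  length (filter P? (row ++ rest))                 ≡⟨ cong length (List.filter-++ P? row rest) ⟩
  length (filter P? row ++ filter P? rest)         ≡⟨ List.length-++ (filter P? row) ⟩
  length (filter P? row) + length (filter P? rest)
    ≡⟨ cong₂ _+_ (trans (length-filter-map P? (f zero ,_) (List.tabulate g))
                        (length-filter-tabulate (P? ∘ (f zero ,_)) g))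
                 (length-filter-cartesianProduct P? (f ∘ suc) g) ⟩
  _                                                ∎
  where
  open ≡-Reasoning
  row  = map (f zero ,_) (List.tabulate g)
  rest = cartesianProduct (List.tabulate (f ∘ suc)) (List.tabulate g)

-- Transposing the second copy of the count by `∑-comm` leaves, at each ordered adjacent pair, the
-- indicators of `u < v` and `v < u`, of which at most one holds.
handshake : (G : Graph (Fin n)) → e G + e G ≤ sum (deg G)
handshake {n} G = begin
  e G + e G                                     ≡⟨ cong₂ _+_ e≡ (trans e≡ (∑-comm up)) ⟩
  sum (λ u → sum (up u)) + sum (λ u → sum (λ v → up v u))
    ≤⟨ sum-+-mono _ _ _ (λ u → sum-+-mono _ _ _ (both u)) ⟩
  sum (λ u → sum (λ v → ⟦ Adj? G u v ⟧))        ≡⟨ sum-cong-≗ (λ u → deg-sum G u) ⟨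
  sum (deg G)                                   ∎
  where
  open ≤-Reasoning
  up : Fin n → Fin n → ℕ
  up u v = ⟦ (u Fin.<? v) ×-dec Adj? G u v ⟧
  e≡ : e G ≡ sum (λ u → sum (up u))
  e≡ = length-filter-cartesianProduct (λ (u , v) → (u Fin.<? v) ×-dec Adj? G u v) id id
  both : ∀ u v → up u v + up v u ≤ ⟦ Adj? G u v ⟧
  both u v = ⟦⟧-disjoint ((u Fin.<? v) ×-dec Adj? G u v)
    ((v Fin.<? u) ×-dec Adj? G v u) (Adj? G u v)
    proj₂ (symm G ∘ proj₂) λ ((u<v , _) , (v<u , _)) → <-asym u<v v<u

sum-∈ : (S : Subset n) → sum (λ i → ⟦ i ∈? S ⟧) ≡ ∣ S ∣
sum-∈ []            = refl
sum-∈ (inside  ∷ S) = cong suc (sum-∈ S)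
sum-∈ (outside ∷ S) = sum-∈ S

sum-≟ : (a : Fin n) → sum (λ i → ⟦ i Fin.≟ a ⟧) ≡ 1
sum-≟ {suc n} zero    = cong suc (trans (sum-const n 0) (*-zeroʳ n))
sum-≟ {suc n} (suc a) = trans (sum-cong-≗ shift) (sum-≟ a)
  where
  shift : ∀ i → ⟦ suc i Fin.≟ suc a ⟧ ≡ ⟦ i Fin.≟ a ⟧
  shift i with i Fin.≟ a
  ... | yes _ = refl
  ... | no _  = refl

module _ {P : Fin n → Set} (P? : Decidable P) where

  ⟪_⟫ : Subset n
  ⟪_⟫ = tabulate (does ∘ P?)

  ∈-⟪⟫⁺ : ∀ {v} → P v → v ∈ ⟪_⟫
  ∈-⟪⟫⁺ {v} p = lookup⇒[]= v _ (trans (lookup∘tabulate _ v) (dec-true (P? v) p))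

  ∈-⟪⟫⁻ : ∀ {v} → v ∈ ⟪_⟫ → P v
  ∈-⟪⟫⁻ {v} v∈ with P? v | trans (sym (lookup∘tabulate (does ∘ P?) v)) ([]=⇒lookup v∈)
  ... | yes p | _ = p
  ... | no _  | ()

  ∣⟪⟫∣ : ∣ ⟪_⟫ ∣ ≡ sum (λ v → ⟦ P? v ⟧)
  ∣⟪⟫∣ = trans (sym (sum-∈ ⟪_⟫)) (sum-cong-≗ λ v → ≤-antisym
    (⟦⟧-mono (v ∈? ⟪_⟫) (P? v) ∈-⟪⟫⁻) (⟦⟧-mono (P? v) (v ∈? ⟪_⟫) ∈-⟪⟫⁺))

-- A refinement carries its proof irrelevantly; as membership is decidable, a usable proof can be
-- recomputed.
∉-proof : {S : Subset n} (v : [ w ∈ Fin n ∣ w ∉ S ]) → value v ∉ S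
∉-proof {S = S} (v , [ v∉S ]) = recompute (¬? (v ∈? S)) v∉S

connected-mono : ∀ {t} {G H : Graph (Fin n)} → G ⊆ᴳ H → (t -Connected) G → (t -Connected) H
connected-mono G⊆H (conn , t<n , cut) =
  (λ u v → Star.map G⊆H (conn u v)) , t<n , λ S S<t u v → Star.map G⊆H (cut S S<t u v)

-- If S had fewer than t vertices, a walk from x to y would avoid S, and closedness would carry X
-- along it to y.
separator-size : ∀ {t} (G : Graph (Fin n)) → (t -Connected) G → (S : Subset n) (X : Fin n → Set) →
                 (∀ {u w} → X u → w ∉ S → Adj G u w → X w) →
                 ∀ {x y} → x ∉ S → X x → y ∉ S → ¬ X y → t ≤ ∣ S ∣
separator-size {n} G (_ , _ , cut) S X closed {x} {y} x∉S Xx y∉S ¬Xy =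
  ≮⇒≥ λ S<t → ¬Xy (walk (cut S S<t (x , [ x∉S ]) (y , [ y∉S ])) Xx)
  where
  walk : ∀ {u w} → Star (Adj (G ∖ S)) u w → X (value u) → X (value w)
  walk ε Xu = Xu
  walk (_◅_ {j = j} uj rest) Xu = walk rest (closed Xu (∉-proof j) uj)

-- The neighbourhood of v separates v from every other vertex that v misses. If v misses none, then
-- n ≤ deg v + 1, which is at most t when deg v < t, against t < n.
min-degree : ∀ {t} (G : Graph (Fin n)) → (t -Connected) G → ∀ v → t ≤ deg G v
min-degree {n} {t} G conn@(_ , t<n , _) v = ≮⇒≥ λ d<t →
  let (y , y≢v , ¬vy) = far d<t in
  <⇒≱ d<t (subst (t ≤_) (trans (∣⟪⟫∣ (Adj? G v)) (sym (deg-sum G v)))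
    (separator-size G conn ⟪ Adj? G v ⟫ (_≡ v)
      (λ { refl w∉ vw → contradiction (∈-⟪⟫⁺ (Adj? G v) vw) w∉ })
      (irrefl G ∘ ∈-⟪⟫⁻ (Adj? G v)) refl (¬vy ∘ ∈-⟪⟫⁻ (Adj? G v)) y≢v))
  where
  far : deg G v < t → ∃ λ y → y ≢ v × ¬ Adj G v y
  far d<t with Fin.any? (λ y → ¬? (y Fin.≟ v) ×-dec ¬? (Adj? G v y))
  ... | yes found = found
  ... | no none = contradiction n≤ (<⇒≱ (≤-<-trans d<t t<n))
    where
    one : ∀ y → 1 ≤ ⟦ y Fin.≟ v ⟧ + ⟦ Adj? G v y ⟧
    one y with y Fin.≟ v | Adj? G v y
    ... | yes _  | _      = s≤s z≤n
    ... | no _   | yes _  = s≤s z≤n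
    ... | no y≢v | no ¬vy = contradiction (y , y≢v , ¬vy) none
    n≤ : n ≤ suc (deg G v)
    n≤ = begin
      n
        ≡⟨ trans (sum-const n 1) (*-identityʳ n) ⟨
      sum {n} (λ _ → 1)
        ≤⟨ sum-mono one ⟩
      sum (λ y → ⟦ y Fin.≟ v ⟧ + ⟦ Adj? G v y ⟧)
        ≡⟨ ∑-distrib-+ (λ y → ⟦ y Fin.≟ v ⟧) _ ⟩
      sum (λ y → ⟦ y Fin.≟ v ⟧) + sum (λ y → ⟦ Adj? G v y ⟧)
        ≡⟨ cong₂ _+_ (sum-≟ v) (sym (deg-sum G v)) ⟩
      suc (deg G v) ∎
      where open ≤-Reasoning

-- Matchings and the closure

-- A perfect matching of G ∖ S as an involution of all of Fin n; its values on
-- S are irrelevant except that they stay in S.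
record Matching (G : Graph (Fin n)) (S : Subset n) : Set where
  field
    partner    : Fin n → Fin n
    involutive : ∀ v → partner (partner v) ≡ v
    avoids     : ∀ {v} → v ∉ S → partner v ∉ S
    adjacent   : ∀ {v} → v ∉ S → Adj G v (partner v)

open Matching

value-injective : {S : Subset n} {u v : [ w ∈ Fin n ∣ w ∉ S ]} → value u ≡ value v → u ≡ v
value-injective refl = refl

perfect : {G : Graph (Fin n)} {S : Subset n} → Matching G S → HasPerfectMatching (G ∖ S)
perfect {n} {G} {S} M = graph , (λ {u} {v} → M⊆G {u} {v}) , λ v →
  partner′ v , refl , λ {w} → value-injective {u = partner′ v} {w}
  where
  p = partner M

  partner′ : [ w ∈ Fin n ∣ w ∉ S ] → [ w ∈ Fin n ∣ w ∉ S ]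
  partner′ v = p (value v) , [ avoids M (∉-proof v) ]

  M⊆G : ∀ {u v : [ w ∈ Fin n ∣ w ∉ S ]} → p (value u) ≡ value v → Adj G (value u) (value v)
  M⊆G {u} eq = subst (Adj G (value u)) eq (adjacent M (∉-proof u))

  graph : Graph [ w ∈ Fin n ∣ w ∉ S ]
  graph = record
    { Adj    = λ u v → p (value u) ≡ value v
    ; Adj?   = λ u v → p (value u) Fin.≟ value v
    ; symm   = λ {u} {v} eq → trans (cong p (sym eq)) (involutive M (value u))
    ; irrefl = λ {v} eq → irrefl G (M⊆G {v} {v} eq)
    }

module _ (x y : Fin n) where

  τ : Fin n → Fin n
  τ = transpose x y

  τ-cases : ∀ w → (w ≡ x × τ w ≡ y) ⊎ (w ≡ y × τ w ≡ x) ⊎ (w ≢ x × w ≢ y × τ w ≡ w)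
  τ-cases w with w Fin.≟ x
  ... | yes w≡x = inj₁ (w≡x , refl)
  ... | no w≢x with w Fin.≟ y
  ...   | yes w≡y = inj₂ (inj₁ (w≡y , refl))
  ...   | no w≢y  = inj₂ (inj₂ (w≢x , w≢y , refl))

  τ-involutive : ∀ w → τ (τ w) ≡ w
  τ-involutive w with τ-cases w
  ... | inj₂ (inj₂ (_ , _ , eq)) = trans (cong τ eq) eq
  ... | inj₁ (refl , eq) with τ-cases (τ w)
  -- Here x and y coincide, which is not excluded.
  ...   | inj₁ (eq′ , r) = trans r (trans (sym eq) eq′)
  ...   | inj₂ (inj₁ (_ , r)) = r
  ...   | inj₂ (inj₂ (_ , ≢y , _)) = contradiction eq ≢y
  τ-involutive w | inj₂ (inj₁ (refl , eq)) with τ-cases (τ w)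
  ...   | inj₁ (_ , r) = r
  ...   | inj₂ (inj₁ (eq′ , r)) = trans r (trans (sym eq) eq′)
  ...   | inj₂ (inj₂ (≢x , _ , _)) = contradiction eq ≢x

module _ {G : Graph (Fin n)} {S : Subset n} {u v : Fin n} (u≢v : u ≢ v)
         (M : Matching (addEdge G u v u≢v) S) where
  private
    p = partner M

  -- The condition `u ∉ S` matters because partners inside S are arbitrary: only a pair outside S
  -- uses the edge uv.
  unused-edge : ¬ (u ∉ S × p u ≡ v) → Matching G S
  unused-edge unused = record
    { partner = p ; involutive = involutive M ; avoids = avoids M ; adjacent = adj }
    where
    adj : ∀ {w} → w ∉ S → Adj G w (p w)
    adj {w} w∉S with adjacent M w∉S
    ... | inj₁ wp                    = wp
    ... | inj₂ (inj₁ (refl , eq)) = contradiction (w∉S , eq) unused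
    ... | inj₂ (inj₂ (refl , eq)) = contradiction
      (subst (_∉ S) eq (avoids M w∉S) , trans (cong p (sym eq)) (involutive M w)) unused

  module _ (¬uv : ¬ Adj G u v) (u∉S : u ∉ S) (pu≡v : p u ≡ v) where

    private
      pv≡u : p v ≡ u
      pv≡u = trans (cong p (sym pu≡v)) (involutive M u)

      v∉S : v ∉ S
      v∉S = subst (_∉ S) pu≡v (avoids M u∉S)

      old : ∀ {w} → w ∉ S → w ≢ u → w ≢ v → Adj G w (p w)
      old w∉S w≢u w≢v with adjacent M w∉S
      ... | inj₁ wp              = wp
      ... | inj₂ (inj₁ (eq , _)) = contradiction eq w≢u
      ... | inj₂ (inj₂ (eq , _)) = contradiction eq w≢v

    -- Replaces uv and x(p x) by ux and v(p x), that is, conjugates p by the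
    -- transposition of v and x.
    rematch : ∀ {x} → x ∉ S → Adj G u x → Adj G v (p x) → Matching G S
    rematch {x} x∉S ux vy = record
      { partner    = λ w → t (p (t w))
      ; involutive = λ w → trans (cong (t ∘ p) (τ-involutive v x (p (t w))))
                          (trans (cong t (involutive M (t w))) (τ-involutive v x w))
      ; avoids     = λ w∉S → t∉S (avoids M (t∉S w∉S))
      ; adjacent   = adj
      }
      where
      t = τ v x

      t∉S : ∀ {w} → w ∉ S → t w ∉ S
      t∉S {w} w∉S with τ-cases v x w
      ... | inj₁ (_ , eq)            = subst (_∉ S) (sym eq) x∉S
      ... | inj₂ (inj₁ (_ , eq))     = subst (_∉ S) (sym eq) v∉S
      ... | inj₂ (inj₂ (_ , _ , eq)) = subst (_∉ S) (sym eq) w∉S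

      p-injective : ∀ {a b} → p a ≡ p b → a ≡ b
      p-injective {a} {b} eq = trans (sym (involutive M a)) (trans (cong p eq) (involutive M b))

      u≢x : u ≢ x
      u≢x eq = irrefl G (subst (Adj G u) (sym eq) ux)

      x≢v : x ≢ v
      x≢v refl = ¬uv ux

      px≢x : p x ≢ x
      px≢x eq = irrefl G (subst (Adj G x) eq (old x∉S (≢-sym u≢x) x≢v))

      t-fixes : ∀ {w} → w ≢ v → w ≢ x → t w ≡ w
      t-fixes {w} w≢v w≢x with τ-cases v x w
      ... | inj₁ (eq , _)            = contradiction eq w≢v
      ... | inj₂ (inj₁ (eq , _))     = contradiction eq w≢x
      ... | inj₂ (inj₂ (_ , _ , eq)) = eq

      adj : ∀ {w} → w ∉ S → Adj G w (t (p (t w)))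
      -- The new partners are v to p x, x to u, u to x and p x to v, in the order of the cases
      -- below; all other vertices keep theirs.
      adj {w} w∉S with τ-cases v x w
      ... | inj₁ (refl , eq) = subst (Adj G v) (sym (trans (cong (t ∘ p) eq) (t-fixes px≢v px≢x))) vy
        where
        px≢v : p x ≢ v
        px≢v px≡v = u≢x (p-injective (trans pu≡v (sym px≡v)))
      ... | inj₂ (inj₁ (refl , eq)) =
        subst (Adj G x) (sym (trans (cong (t ∘ p) eq) (trans (cong t pv≡u) (t-fixes u≢v u≢x))))
          (symm G ux)
      ... | inj₂ (inj₂ (w≢v , w≢x , eq)) with τ-cases v x (p w)
      ...   | inj₁ (pw≡v , r) = subst₂ (Adj G) (p-injective (trans pu≡v (sym pw≡v)))
                                  (sym (trans (cong (t ∘ p) eq) r)) ux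
      ...   | inj₂ (inj₁ (pw≡x , r)) = subst₂ (Adj G)
                                  (trans (cong p (sym pw≡x)) (involutive M w))
                                  (sym (trans (cong (t ∘ p) eq) r)) (symm G vy)
      ...   | inj₂ (inj₂ (pw≢v , _ , r)) = subst (Adj G w) (sym (trans (cong (t ∘ p) eq) r))
                                  (old w∉S (λ { refl → pw≢v pu≡v }) w≢v)

    -- If no x admits rematching, then [ux] + [v(p x)] ≤ 1 for every x ∉ S, and
    -- the sum is 0 for x = u and for x = v.
    rematch-exists : n + ∣ S ∣ < deg G u + deg G v + 2 → Matching G S
    rematch-exists big with Fin.any? (λ x → ¬? (x ∈? S) ×-dec Adj? G u x ×-dec Adj? G v (p x))
    ... | yes (x , x∉S , ux , vy) = rematch x∉S ux vy
    ... | no none = contradiction big (≤⇒≯ (begin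
      deg G u + deg G v + 2
        -- The degree of v is reindexed along p, and the 2 is spread as one unit at u and one at v,
        -- where f + g vanishes.
        ≡⟨ cong₂ _+_ (cong₂ _+_ (deg-sum G u) (trans (deg-sum G v) (sum-permute _ π)))
                     (sym (cong₂ _+_ (sum-≟ u) (sum-≟ v))) ⟩
      sum f + sum g + (sum f₁ + sum g₁)
        ≡⟨ cong₂ _+_ (∑-distrib-+ f g) (∑-distrib-+ f₁ g₁) ⟨
      sum (λ x → f x + g x) + sum (λ x → f₁ x + g₁ x)
        ≤⟨ sum-+-mono _ _ _ pointwise ⟩
      sum (λ x → 1 + ⟦ x ∈? S ⟧)
        ≡⟨ ∑-distrib-+ (λ _ → 1) (λ x → ⟦ x ∈? S ⟧) ⟩
      sum {n} (λ _ → 1) + sum (λ x → ⟦ x ∈? S ⟧)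
        ≡⟨ cong₂ _+_ (trans (sum-const n 1) (*-identityʳ n)) (sum-∈ S) ⟩
      n + ∣ S ∣ ∎))
      where
      open ≤-Reasoning
      π = permutation p p (involutive M) (involutive M)
      f g f₁ g₁ : Fin n → ℕ
      f x = ⟦ Adj? G u x ⟧
      g x = ⟦ Adj? G v (p x) ⟧
      f₁ x = ⟦ x Fin.≟ u ⟧
      g₁ x = ⟦ x Fin.≟ v ⟧

      pointwise : ∀ x → f x + g x + (f₁ x + g₁ x) ≤ 1 + ⟦ x ∈? S ⟧
      -- `τ-cases` serves here only to split into x = u, x = v and neither.
      pointwise x with τ-cases u v x
      ... | inj₁ (refl , _)
        rewrite ⟦⟧-no (Adj? G u u) (irrefl G)
              | ⟦⟧-no (Adj? G v (p u)) (irrefl G ∘ subst (Adj G v) pu≡v)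
              | ⟦⟧-yes (u Fin.≟ u) refl | ⟦⟧-no (u Fin.≟ v) u≢v = m≤m+n 1 _
      ... | inj₂ (inj₁ (refl , _))
        rewrite ⟦⟧-no (Adj? G u v) ¬uv
              | ⟦⟧-no (Adj? G v (p v)) (¬uv ∘ symm G ∘ subst (Adj G v) pv≡u)
              | ⟦⟧-yes (v Fin.≟ v) refl | ⟦⟧-no (v Fin.≟ u) (≢-sym u≢v) = m≤m+n 1 _
      ... | inj₂ (inj₂ (x≢u , x≢v , _))
        rewrite ⟦⟧-no (x Fin.≟ u) x≢u | ⟦⟧-no (x Fin.≟ v) x≢v
              | +-identityʳ (f x + g x) = most (x ∈? S)
        where
        most : (d : Dec (x ∈ S)) → f x + g x ≤ 1 + ⟦ d ⟧
        most (yes _)  = +-mono-≤ (⟦⟧≤1 (Adj? G u x)) (⟦⟧≤1 (Adj? G v (p x)))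
        most (no x∉S) = ⟦⟧-disjoint (Adj? G u x) (Adj? G v (p x)) (yes tt) _ _
                          λ (ux , vy) → none (x , x∉S , ux , vy)

-- A join requires degree sum at least l, which is at least n + ∣ S ∣ - 1: just what the count in
-- `rematch-exists` asks for.
unstep : ∀ {l} {G H : Graph (Fin n)} {S : Subset n} → n + ∣ S ∣ ≤ suc l → Step l G H →
         Matching H S → Matching G S
unstep {n} {l} {G} {S = S} n+k≤ (join {u} {v} (u≢v , ¬uv , l≤)) M
  with ¬? (u ∈? S) ×-dec (partner M u Fin.≟ v)
... | no unused = unused-edge u≢v M unused
... | yes (u∉S , pu≡v) = rematch-exists u≢v M ¬uv u∉S pu≡v (begin
    suc (n + ∣ S ∣)           ≤⟨ s≤s n+k≤ ⟩
    2 + l                   ≡⟨ +-comm 2 l ⟩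
    l + 2                   ≤⟨ +-monoˡ-≤ 2 l≤ ⟩
    deg G u + deg G v + 2   ∎)
  where open ≤-Reasoning

unsteps : ∀ {l} {G H : Graph (Fin n)} {S : Subset n} → n + ∣ S ∣ ≤ suc l → Star (Step l) G H →
          Matching H S → Matching G S
unsteps n+k≤ ε          M = M
unsteps n+k≤ (s ◅ rest) M = unstep n+k≤ s (unsteps n+k≤ rest M)

-- Classes of a colouring

⟦⟧-index : {P : Set} (d : Dec P) → P → Fin ⟦ d ⟧
⟦⟧-index (yes _) _ = zero
⟦⟧-index (no ¬p) p = contradiction p ¬p

⟦⟧-witness : {P : Set} (d : Dec P) → Fin ⟦ d ⟧ → P
⟦⟧-witness (yes p) _ = p

⟦⟧-unique : {P : Set} (d : Dec P) (i j : Fin ⟦ d ⟧) → i ≡ j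
⟦⟧-unique (yes _) zero zero = refl

module Classes {Colour : Set} (_≟_ : DecidableEquality Colour) where

  size : (Fin n → Colour) → Colour → ℕ
  size f c = sum (λ v → ⟦ f v ≟ c ⟧)

  -- `size f c` unfolds to `⟦ f zero ≟ c ⟧ + size (f ∘ suc) c`, so an index below it either is the
  -- vertex `zero`, present only if it has colour c, or points to a later vertex. The rank is the
  -- position of v within its own colour.
  rank : (f : Fin n → Colour) (v : Fin n) → Fin (size f (f v))
  rank f zero    = ⟦⟧-index (f zero ≟ f zero) refl ↑ˡ _
  rank f (suc v) = ⟦ f zero ≟ f (suc v) ⟧ ↑ʳ rank (f ∘ suc) v

  member : (f : Fin n → Colour) (c : Colour) → Fin (size f c) → Fin n
  member {suc n} f c j = Sum.[ (λ _ → zero) , suc ∘ member (f ∘ suc) c ] (splitAt ⟦ f zero ≟ c ⟧ j)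

  member-colour : (f : Fin n → Colour) (c : Colour) (j : Fin (size f c)) → f (member f c j) ≡ c
  member-colour {suc n} f c j with splitAt ⟦ f zero ≟ c ⟧ j
  ... | inj₁ i = ⟦⟧-witness (f zero ≟ c) i
  ... | inj₂ i = member-colour (f ∘ suc) c i

  member-rank : (f : Fin n → Colour) (v : Fin n) → member f (f v) (rank f v) ≡ v
  member-rank f zero
    rewrite Fin.splitAt-↑ˡ _ (⟦⟧-index (f zero ≟ f zero) refl) (size (f ∘ suc) (f zero)) = refl
  member-rank f (suc v)
    rewrite Fin.splitAt-↑ʳ ⟦ f zero ≟ f (suc v) ⟧ _ (rank (f ∘ suc) v) =
    cong suc (member-rank (f ∘ suc) v)

  member-injective : (f : Fin n → Colour) (c : Colour) {i j : Fin (size f c)} →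
                     member f c i ≡ member f c j → i ≡ j
  member-injective {suc n} f c {i} {j} eq =
    trans (sym (Fin.join-splitAt a b i))
      (trans (cong (Fin.join a b) (go (splitAt a i) (splitAt a j) eq)) (Fin.join-splitAt a b j))
    where
    a = ⟦ f zero ≟ c ⟧
    b = size (f ∘ suc) c
    vertex : Fin a ⊎ Fin b → Fin (suc n)
    vertex = Sum.[ (λ _ → zero) , suc ∘ member (f ∘ suc) c ]
    go : ∀ x y → vertex x ≡ vertex y → x ≡ y
    go (inj₁ x) (inj₁ y) _  = cong inj₁ (⟦⟧-unique (f zero ≟ c) x y)
    go (inj₂ x) (inj₂ y) eq = cong inj₂ (member-injective (f ∘ suc) c (Fin.suc-injective eq))

  -- `member-rank` is one inverse law. The other follows by applying it to `from x`: the colours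
  -- agree, and `from` is injective on each colour. The colours will be the two sides of S, and then
  -- the parts of the extremal graph.
  classes : (f : Fin n → Colour) → Fin n ↔ Σ Colour (Fin ∘ size f)
  classes f = mk↔ₛ′ to from to-from (member-rank f)
    where
    to : Fin _ → Σ Colour (Fin ∘ size f)
    to v = f v , rank f v
    from : Σ Colour (Fin ∘ size f) → Fin _
    from (c , j) = member f c j
    from-injective : ∀ {x y} → proj₁ x ≡ proj₁ y → from x ≡ from y → x ≡ y
    from-injective {c , _} refl eq = cong (c ,_) (member-injective f c eq)
    to-from : ∀ x → to (from x) ≡ x
    to-from (c , j) = from-injective (member-colour f c j) (member-rank f (member f c j))

-- Perfect matchings of complete graphs

FixedPointFreeInvolution : Set → Set
FixedPointFreeInvolution A = Σ[ σ ∈ (A → A) ] (∀ a → σ (σ a) ≡ a) × (∀ a → σ a ≢ a)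

swap-halves : ∀ h → FixedPointFreeInvolution (Fin (h + h))
swap-halves h = σ , σ-involutive , σ-moves
  where
  σ : Fin (h + h) → Fin (h + h)
  σ = Fin.join h h ∘ Sum.swap ∘ splitAt h

  splitAt-σ : ∀ i → splitAt h (σ i) ≡ Sum.swap (splitAt h i)
  splitAt-σ i = Fin.splitAt-join h h _

  σ-involutive : ∀ i → σ (σ i) ≡ i
  σ-involutive i = trans (cong (Fin.join h h ∘ Sum.swap) (splitAt-σ i))
    (trans (cong (Fin.join h h) (swap-involutive (splitAt h i))) (Fin.join-splitAt h h i))

  σ-moves : ∀ i → σ i ≢ i
  σ-moves i eq with splitAt h i | trans (sym (splitAt-σ i)) (cong (splitAt h) eq)
  ... | inj₁ _ | ()
  ... | inj₂ _ | ()

-- In a complete graph any fixed-point-free involution of the vertices outside S is a perfect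
-- matching. There are h + h of them, so exchanging two halves gives one; vertices of S stay fixed.
complete-matching : (G : Graph (Fin n)) → (∀ {u v} → u ≢ v → Adj G u v) →
                    (S : Subset n) → ∀ h → n ≡ h + h + ∣ S ∣ → Matching G S
complete-matching {n} G complete S h n≡ = record
  { partner    = λ v → from (φ (to v))
  ; involutive = λ v → trans (cong (from ∘ φ) (strictlyInverseˡ (φ (to v))))
                      (trans (cong from (φ-involutive (to v))) (strictlyInverseʳ v))
  ; avoids     = λ {v} v∉S → outside-∉ (trans (colour-φ v) (dec-false (v ∈? S) v∉S))
  ; adjacent   = λ {v} v∉S → complete λ eq →
      φ-moves (to v) (dec-false (v ∈? S) v∉S)
        (trans (sym (strictlyInverseˡ (φ (to v)))) (cong to (sym eq)))
  }
  where
  open Classes Bool._≟_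
  f : Fin n → Bool
  f v = does (v ∈? S)
  open Inverse (classes f) using (to; from; strictlyInverseˡ; strictlyInverseʳ)

  outside-∉ : ∀ {v} → f v ≡ false → v ∉ S
  outside-∉ {v} eq v∈S with trans (sym eq) (dec-true (v ∈? S) v∈S)
  ... | ()

  size-false : size f false ≡ h + h
  size-false = +-cancelʳ-≡ ∣ S ∣ _ _ (trans (begin
    size f false + ∣ S ∣                     ≡⟨ cong (size f false +_) (sum-∈ S) ⟨
    size f false + sum (λ v → ⟦ v ∈? S ⟧)    ≡⟨ ∑-distrib-+ (λ v → ⟦ f v Bool.≟ false ⟧) _ ⟨
    sum (λ v → ⟦ f v Bool.≟ false ⟧ + ⟦ v ∈? S ⟧) ≡⟨ sum-cong-≗ (λ v → one (v ∈? S)) ⟩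
    sum {n} (λ _ → 1)                        ≡⟨ sum-const n 1 ⟩
    n * 1                                    ≡⟨ *-identityʳ n ⟩
    n                                        ∎) n≡)
    where
    open ≡-Reasoning
    one : {P : Set} (d : Dec P) → ⟦ does d Bool.≟ false ⟧ + ⟦ d ⟧ ≡ 1
    one (yes _) = refl
    one (no _)  = refl

  swapping : FixedPointFreeInvolution (Fin (size f false))
  swapping = subst (FixedPointFreeInvolution ∘ Fin) (sym size-false) (swap-halves h)

  φ : Σ Bool (Fin ∘ size f) → Σ Bool (Fin ∘ size f)
  φ (true  , j) = true , j
  φ (false , j) = false , proj₁ swapping j

  φ-involutive : ∀ x → φ (φ x) ≡ x
  φ-involutive (true  , j) = refl
  φ-involutive (false , j) = cong (false ,_) (proj₁ (proj₂ swapping) j)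

  φ-moves : ∀ x → proj₁ x ≡ false → φ x ≢ x
  φ-moves (false , j) _ eq with proj₁ swapping j | proj₂ (proj₂ swapping) j
  φ-moves (false , j) _ refl | _ | moves = moves refl

  colour-φ : ∀ v → f (from (φ (to v))) ≡ f v
  colour-φ v = trans (cong proj₁ (strictlyInverseˡ (φ (to v)))) (φ-colour (to v))
    where
    φ-colour : ∀ x → proj₁ (φ x) ≡ proj₁ x
    φ-colour (true  , _) = refl
    φ-colour (false , _) = refl

-- The extremal graph

-- The blocks of `K a ∨ (K b ⊕ (c · K 1))`: `joint` is `K a`, `clique` is `K b`, and `single`
-- consists of the c isolated vertices.
data Part : Set where
  joint clique single : Part

_≟ᴾ_ : DecidableEquality Part
joint  ≟ᴾ joint  = yes refl
joint  ≟ᴾ clique = no λ ()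
joint  ≟ᴾ single = no λ ()
clique ≟ᴾ joint  = no λ ()
clique ≟ᴾ clique = yes refl
clique ≟ᴾ single = no λ ()
single ≟ᴾ joint  = no λ ()
single ≟ᴾ clique = no λ ()
single ≟ᴾ single = yes refl

Linked : Part → Part → Set
Linked clique single = ⊥
Linked single clique = ⊥
Linked single single = ⊥
Linked _      _      = ⊤

module _ where
  open Classes _≟ᴾ_

  -- Each vertex goes to its part and its rank there. Adjacency of distinct vertices depends on
  -- their parts alone, so any bijection respecting the parts is an isomorphism.
  extremal-≅ : (G : Graph (Fin n)) (f : Fin n → Part) →
               (∀ u v → Adj G u v ⇔ (u ≢ v × Linked (f u) (f v))) →
               ∀ {a b c} → size f joint ≡ a → size f clique ≡ b → size f single ≡ c →
               G ≅ (K a ∨ (K b ⊕ (c · K 1)))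
  extremal-≅ {n} G f adj refl refl refl = mk↔ₛ′ (arrange ∘ to) (from ∘ restore)
      (λ y → trans (cong arrange (strictlyInverseˡ (restore y))) (arrange-restore y))
      (λ v → trans (cong from (restore-arrange (to v))) (strictlyInverseʳ v))
    , λ u v → mk⇔
        (λ uv → let (u≢v , l) = Equivalence.to (adj u v) uv in
                arranged⁺ (to u) (to v) (u≢v ∘ to-injective u v) l)
        (λ a → let (x≢y , l) = arranged⁻ (to u) (to v) a in
               Equivalence.from (adj u v) (x≢y ∘ cong to , l))
    where
    open Inverse (classes f) using (to; from; strictlyInverseˡ; strictlyInverseʳ)

    to-injective : ∀ u v → to u ≡ to v → u ≡ v
    to-injective u v eq = trans (sym (strictlyInverseʳ u)) (trans (cong from eq) (strictlyInverseʳ v))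

    W : Set
    W = Fin (size f joint) ⊎ Fin (size f clique) ⊎ (Fin (size f single) × Fin 1)

    E : Graph W
    E = K _ ∨ (K _ ⊕ (_ · K 1))

    arrange : Σ Part (Fin ∘ size f) → W
    arrange (joint  , i) = inj₁ i
    arrange (clique , i) = inj₂ (inj₁ i)
    arrange (single , i) = inj₂ (inj₂ (i , zero))

    restore : W → Σ Part (Fin ∘ size f)
    restore (inj₁ i)              = joint , i
    restore (inj₂ (inj₁ i))       = clique , i
    restore (inj₂ (inj₂ (i , _))) = single , i

    arrange-restore : ∀ y → arrange (restore y) ≡ y
    arrange-restore (inj₁ i)                 = refl
    arrange-restore (inj₂ (inj₁ i))          = refl
    arrange-restore (inj₂ (inj₂ (i , zero))) = refl

    restore-arrange : ∀ x → restore (arrange x) ≡ x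
    restore-arrange (joint  , i) = refl
    restore-arrange (clique , i) = refl
    restore-arrange (single , i) = refl

    arranged⁺ : ∀ x y → x ≢ y → Linked (proj₁ x) (proj₁ y) → Adj E (arrange x) (arrange y)
    arranged⁺ (joint  , i) (joint  , j) x≢y _ = x≢y ∘ cong (joint ,_)
    arranged⁺ (joint  , i) (clique , j) x≢y _ = tt
    arranged⁺ (joint  , i) (single , j) x≢y _ = tt
    arranged⁺ (clique , i) (joint  , j) x≢y _ = tt
    arranged⁺ (clique , i) (clique , j) x≢y _ = x≢y ∘ cong (clique ,_)
    arranged⁺ (single , i) (joint  , j) x≢y _ = tt

    arranged⁻ : ∀ x y → Adj E (arrange x) (arrange y) → x ≢ y × Linked (proj₁ x) (proj₁ y)
    arranged⁻ (joint  , i) (joint  , j) i≢j = (λ { refl → i≢j refl }) , tt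
    arranged⁻ (joint  , i) (clique , j) _ = (λ ()) , tt
    arranged⁻ (joint  , i) (single , j) _ = (λ ()) , tt
    arranged⁻ (clique , i) (joint  , j) _ = (λ ()) , tt
    arranged⁻ (clique , i) (clique , j) i≢j = (λ { refl → i≢j refl }) , tt
    arranged⁻ (single , i) (joint  , j) _ = (λ ()) , tt
    arranged⁻ (single , i) (single , j) (_ , 0≢0) = contradiction refl 0≢0

-- Cliques and degree sums

IsClique : Graph (Fin n) → Subset n → Set
IsClique G K = ∀ {u v} → u ∈ K → v ∈ K → u ≢ v → Adj G u v

-- Phrased through a missed vertex, because that non-adjacent pair is what the degree-sum bound is
-- applied to.
IsMaximal : Graph (Fin n) → Subset n → Set
IsMaximal G K = ∀ {w} → w ∉ K → ∃ λ c → c ∈ K × ¬ Adj G w c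

-- Greedy: one pass over the vertices adds each one that is adjacent to the whole current clique.
-- One pass is enough, since the clique only grows and a missed vertex stays in it.
maximal-clique : (G : Graph (Fin n)) (B : Subset n) → IsClique G B →
                 ∃ λ K → (∀ {v} → v ∈ B → v ∈ K) × IsClique G K × IsMaximal G K
maximal-clique {n} G B B-clique =
  let (K , B⊆K , K-clique , done) = extend (allFin n) B B-clique in
  K , B⊆K , K-clique , λ {w} w∉K → Sum.fromInj₂ (λ w∈K → contradiction w∈K w∉K) (done (∈-allFin w))
  where
  Settled : Subset n → Fin n → Set
  Settled K w = w ∈ K ⊎ ∃ λ c → c ∈ K × ¬ Adj G w c

  extend : ∀ xs B → IsClique G B → ∃ λ K → (∀ {v} → v ∈ B → v ∈ K) × IsClique G K ×
           (∀ {w} → w List.∈ xs → Settled K w)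
  extend [] B cl = B , id , cl , λ ()
  extend (x ∷ xs) B cl with Fin.any? (λ c → (c ∈? B) ×-dec ¬? (Adj? G x c))
  -- A vertex x already in B lands here too, with c = x.
  ... | yes (c , c∈B , ¬xc) =
    let (K , B⊆K , K-clique , done) = extend xs B cl in
    K , B⊆K , K-clique , λ { (here refl) → inj₂ (c , B⊆K c∈B , ¬xc) ; (there w∈) → done w∈ }
  ... | no none =
    let (K , B⊆K , K-clique , done) = extend xs (B ∪ ⁅ x ⁆) cl′ in
    K , B⊆K ∘ x∈p∪q⁺ ∘ inj₁ , K-clique
      , λ { (here refl) → inj₁ (B⊆K (x∈p∪q⁺ {p = B} (inj₂ (x∈⁅x⁆ x)))) ; (there w∈) → done w∈ }
    where
    x-joined : ∀ {c} → c ∈ B → Adj G x c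
    x-joined {c} c∈B = decidable-stable (Adj? G x c) λ ¬xc → none (c , c∈B , ¬xc)

    cl′ : IsClique G (B ∪ ⁅ x ⁆)
    cl′ {u} {v} u∈ v∈ u≢v with x∈p∪q⁻ B ⁅ x ⁆ u∈ | x∈p∪q⁻ B ⁅ x ⁆ v∈
    ... | inj₁ u∈B | inj₁ v∈B = cl u∈B v∈B u≢v
    ... | inj₁ u∈B | inj₂ v∈x with refl ← x∈⁅y⁆⇒x≡y x v∈x = symm G (x-joined u∈B)
    ... | inj₂ u∈x | inj₁ v∈B with refl ← x∈⁅y⁆⇒x≡y x u∈x = x-joined v∈B
    ... | inj₂ u∈x | inj₂ v∈x = contradiction (trans (x∈⁅y⁆⇒x≡y x u∈x) (sym (x∈⁅y⁆⇒x≡y x v∈x))) u≢v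

deg<n : (G : Graph (Fin n)) (v : Fin n) → deg G v < n
deg<n {n} G v = begin
  suc (deg G v)
    ≡⟨ +-comm 1 (deg G v) ⟩
  deg G v + 1
    ≡⟨ cong₂ _+_ (deg-sum G v) (sym (sum-≟ v)) ⟩
  sum (λ u → ⟦ Adj? G v u ⟧) + sum (λ u → ⟦ u Fin.≟ v ⟧)
    ≤⟨ sum-+-mono _ _ _ (λ u → ⟦⟧-disjoint (Adj? G v u) (u Fin.≟ v) (yes tt) _ _
         λ { (vv , refl) → irrefl G vv }) ⟩
  sum {n} (λ _ → 1)
    ≡⟨ trans (sum-const n 1) (*-identityʳ n) ⟩
  n ∎
  where open ≤-Reasoning

⟦⟧-cover : {P Q R : Set} (p? : Dec P) (q? : Dec Q) (r? : Dec R) →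
           (P → ¬ R → Q) → ⟦ p? ⟧ ≤ ⟦ q? ⟧ + ⟦ r? ⟧
⟦⟧-cover (no _)  _  _      _ = z≤n
⟦⟧-cover (yes p) q? (yes _) _ = m≤n+m 1 ⟦ q? ⟧
⟦⟧-cover (yes p) q? (no ¬r) f = ≤-trans (≤-reflexive (sym (⟦⟧-yes q? (f p ¬r)))) (m≤m+n _ 0)

sum-≤-+ : (f g h : Fin n → ℕ) → (∀ i → f i ≤ g i + h i) → sum f ≤ sum g + sum h
sum-≤-+ f g h le = ≤-trans (sum-mono le) (≤-reflexive (∑-distrib-+ g h))

∣S∣<deg : (G : Graph (Fin n)) (S : Subset n) {w x : Fin n} → (∀ {c} → c ∈ S → Adj G w c) →
          x ∉ S → Adj G w x → ∣ S ∣ < deg G w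
∣S∣<deg G S {w} {x} S⊆N x∉S wx = begin
  suc ∣ S ∣
    ≡⟨ +-comm 1 ∣ S ∣ ⟩
  ∣ S ∣ + 1
    ≡⟨ cong₂ _+_ (sum-∈ S) (sum-≟ x) ⟨
  sum (λ u → ⟦ u ∈? S ⟧) + sum (λ u → ⟦ u Fin.≟ x ⟧)
    ≤⟨ sum-+-mono _ _ _ (λ u → ⟦⟧-disjoint (u ∈? S) (u Fin.≟ x) (Adj? G w u) S⊆N
         (λ { refl → wx }) λ { (x∈S , refl) → x∉S x∈S }) ⟩
  sum (λ u → ⟦ Adj? G w u ⟧)
    ≡⟨ deg-sum G w ⟨
  deg G w ∎
  where open ≤-Reasoning

module _ (G : Graph (Fin n)) {K : Subset n} (K-clique : IsClique G K) where

  clique-size-≤ : ∀ {c} → c ∈ K → ∣ K ∣ ≤ deg G c + 1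
  clique-size-≤ {c} c∈K = begin
    ∣ K ∣
      ≡⟨ sum-∈ K ⟨
    sum (λ u → ⟦ u ∈? K ⟧)
      ≤⟨ sum-≤-+ _ _ _ (λ u → ⟦⟧-cover (u ∈? K) (Adj? G c u) (u Fin.≟ c)
           λ u∈K u≢c → K-clique c∈K u∈K (≢-sym u≢c)) ⟩
    sum (λ u → ⟦ Adj? G c u ⟧) + sum (λ u → ⟦ u Fin.≟ c ⟧)
      ≡⟨ cong₂ _+_ (sym (deg-sum G c)) (sum-≟ c) ⟩
    deg G c + 1 ∎
    where open ≤-Reasoning

  -- The neighbour x makes up for c itself: K together with x lies in the closed neighbourhood of c.
  clique-size-≤-deg : ∀ {c x} → c ∈ K → x ∉ K → Adj G c x → ∣ K ∣ ≤ deg G c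
  clique-size-≤-deg {c} {x} c∈K x∉K cx = +-cancelʳ-≤ 1 _ _ (begin
    ∣ K ∣ + 1
      ≡⟨ cong₂ _+_ (sum-∈ K) (sum-≟ x) ⟨
    sum (λ u → ⟦ u ∈? K ⟧) + sum (λ u → ⟦ u Fin.≟ x ⟧)
      ≤⟨ sum-+-mono _ _ _ pointwise ⟩
    sum (λ u → ⟦ Adj? G c u ⟧ + ⟦ u Fin.≟ c ⟧)
      ≡⟨ ∑-distrib-+ (λ u → ⟦ Adj? G c u ⟧) (λ u → ⟦ u Fin.≟ c ⟧) ⟩
    sum (λ u → ⟦ Adj? G c u ⟧) + sum (λ u → ⟦ u Fin.≟ c ⟧)
      ≡⟨ cong₂ _+_ (sym (deg-sum G c)) (sum-≟ c) ⟩
    deg G c + 1 ∎)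
    where
    open ≤-Reasoning
    pointwise : ∀ u → ⟦ u ∈? K ⟧ + ⟦ u Fin.≟ x ⟧ ≤ ⟦ Adj? G c u ⟧ + ⟦ u Fin.≟ c ⟧
    pointwise u = ≤-trans
      (⟦⟧-disjoint (u ∈? K) (u Fin.≟ x) ((u ∈? K) ⊎-dec (u Fin.≟ x)) inj₁ inj₂
        λ { (x∈K , refl) → x∉K x∈K })
      (⟦⟧-cover ((u ∈? K) ⊎-dec (u Fin.≟ x)) (Adj? G c u) (u Fin.≟ c)
        λ { (inj₁ u∈K) u≢c → K-clique c∈K u∈K (≢-sym u≢c) ; (inj₂ refl) _ → cx })

∁size : Subset n → ℕ
∁size K = sum (λ v → ⟦ ¬? (v ∈? K) ⟧)

module _ (K : Subset n) where

  size+∁size : ∣ K ∣ + ∁size K ≡ n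
  size+∁size = begin
    ∣ K ∣ + ∁size K
      ≡⟨ cong (_+ ∁size K) (sum-∈ K) ⟨
    sum (λ v → ⟦ v ∈? K ⟧) + ∁size K
      ≡⟨ ∑-distrib-+ (λ v → ⟦ v ∈? K ⟧) (λ v → ⟦ ¬? (v ∈? K) ⟧) ⟨
    sum (λ v → ⟦ v ∈? K ⟧ + ⟦ ¬? (v ∈? K) ⟧)
      ≡⟨ sum-cong-≗ (λ v → one (v ∈? K)) ⟩
    sum {n} (λ _ → 1)
      ≡⟨ trans (sum-const n 1) (*-identityʳ n) ⟩
    n ∎
    where
    open ≡-Reasoning
    one : {P : Set} (d : Dec P) → ⟦ d ⟧ + ⟦ ¬? d ⟧ ≡ 1
    one (yes _) = refl
    one (no _)  = refl

  sum-∁-bound : (f : Fin n → ℕ) (b : ℕ) → (∀ {v} → v ∉ K → f v ≤ b) →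
                sum (λ v → ⟦ ¬? (v ∈? K) ⟧ * f v) ≤ ∁size K * b
  sum-∁-bound f b le = ≤-trans (sum-mono (λ v → pointwise v (v ∈? K)))
    (≤-reflexive (sym (*-distribʳ-sum b (λ v → ⟦ ¬? (v ∈? K) ⟧))))
    where
    pointwise : ∀ v (d : Dec (v ∈ K)) → ⟦ ¬? d ⟧ * f v ≤ ⟦ ¬? d ⟧ * b
    pointwise v (yes _)  = z≤n
    pointwise v (no v∉K) = +-monoˡ-≤ 0 (le v∉K)

  sum-split-bound : (f : Fin n → ℕ) (a b : ℕ) → (∀ v → f v ≤ a) → (∀ {v} → v ∉ K → f v ≤ b) →
                    sum f ≤ ∣ K ∣ * a + ∁size K * b
  sum-split-bound f a b le-a le-b = begin
    sum f
      ≤⟨ sum-≤-+ _ _ _ (λ v → pointwise v (v ∈? K)) ⟩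
    sum (λ v → ⟦ v ∈? K ⟧ * a) + sum (λ v → ⟦ ¬? (v ∈? K) ⟧ * b)
      ≡⟨ cong₂ _+_ (*-distribʳ-sum a (λ v → ⟦ v ∈? K ⟧)) (*-distribʳ-sum b (λ v → ⟦ ¬? (v ∈? K) ⟧)) ⟨
    sum (λ v → ⟦ v ∈? K ⟧) * a + ∁size K * b
      ≡⟨ cong (λ s → s * a + ∁size K * b) (sum-∈ K) ⟩
    ∣ K ∣ * a + ∁size K * b ∎
    where
    open ≤-Reasoning
    pointwise : ∀ v (d : Dec (v ∈ K)) → f v ≤ ⟦ d ⟧ * a + ⟦ ¬? d ⟧ * b
    pointwise v (yes _)  = ≤-trans (le-a v) (≤-trans (m≤m+n a 0) (m≤m+n _ 0))
    pointwise v (no v∉K) = ≤-trans (le-b v∉K) (m≤m+n b 0)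

  module _ (G : Graph (Fin n)) where

    private
      k k̄ : Fin n → ℕ
      k v = ⟦ v ∈? K ⟧
      k̄ v = ⟦ ¬? (v ∈? K) ⟧

      adj within outward inward : Fin n → Fin n → ℕ
      adj v u     = ⟦ Adj? G v u ⟧
      within v u  = k v * k u
      outward v u = k̄ v * adj v u
      inward v u  = k̄ u * adj v u

    -- An ordered adjacent pair lies in K × K off the diagonal, or has its first
    -- or its second vertex outside K.
    degree-sum-bound : sum (deg G) + ∣ K ∣
                         ≤ ∣ K ∣ * ∣ K ∣ + 2 * sum (λ v → k̄ v * deg G v)
    degree-sum-bound = begin
      sum (deg G) + ∣ K ∣
        ≡⟨ cong₂ _+_ (sum-cong-≗ (deg-sum G)) (trans (sym (sum-∈ K)) (sum-cong-≗ diagonal)) ⟩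
      ∑∑ adj + ∑∑ (λ v u → k v * ⟦ u Fin.≟ v ⟧)
        ≤⟨ sum-+-mono _ _ _ (λ v → sum-+-mono _ _ _ (pointwise v)) ⟩
      ∑∑ (λ v u → within v u + (outward v u + inward v u))
        ≡⟨ trans (∑∑-distrib-+ within (λ v u → outward v u + inward v u))
                 (cong (∑∑ within +_) (∑∑-distrib-+ outward inward)) ⟩
      ∑∑ within + (∑∑ outward + ∑∑ inward)
        ≡⟨ cong₂ _+_ ∑∑-within (cong₂ _+_ (sum-cong-≗ row) (trans (∑-comm inward) (sum-cong-≗ column))) ⟩
      ∣ K ∣ * ∣ K ∣ + (outer + outer)
        ≡⟨ cong (λ z → ∣ K ∣ * ∣ K ∣ + (outer + z)) (+-identityʳ outer) ⟨
      ∣ K ∣ * ∣ K ∣ + 2 * outer ∎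
      where
      open ≤-Reasoning
      outer = sum (λ v → k̄ v * deg G v)

      ∑∑ : (Fin n → Fin n → ℕ) → ℕ
      ∑∑ f = sum (λ v → sum (f v))

      ∑∑-distrib-+ : ∀ f g → ∑∑ (λ v u → f v u + g v u) ≡ ∑∑ f + ∑∑ g
      ∑∑-distrib-+ f g = trans (sum-cong-≗ (λ v → ∑-distrib-+ (f v) (g v)))
                               (∑-distrib-+ (sum ∘ f) (sum ∘ g))

      diagonal : ∀ v → k v ≡ sum (λ u → k v * ⟦ u Fin.≟ v ⟧)
      diagonal v = trans (sym (*-identityʳ (k v)))
        (trans (cong (k v *_) (sym (sum-≟ v))) (*-distribˡ-sum (k v) (λ u → ⟦ u Fin.≟ v ⟧)))

      ∑∑-within : ∑∑ within ≡ ∣ K ∣ * ∣ K ∣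
      ∑∑-within = begin-equality
        ∑∑ within                  ≡⟨ sum-cong-≗ (λ v → *-distribˡ-sum (k v) k) ⟨
        sum (λ v → k v * sum k)    ≡⟨ *-distribʳ-sum (sum k) k ⟨
        sum k * sum k              ≡⟨ cong₂ _*_ (sum-∈ K) (sum-∈ K) ⟩
        ∣ K ∣ * ∣ K ∣              ∎

      row : ∀ v → sum (outward v) ≡ k̄ v * deg G v
      row v = trans (sym (*-distribˡ-sum (k̄ v) (adj v))) (cong (k̄ v *_) (sym (deg-sum G v)))

      adj-sym : ∀ u v → adj v u ≡ adj u v
      adj-sym u v = ≤-antisym (⟦⟧-mono (Adj? G v u) (Adj? G u v) (symm G))
                              (⟦⟧-mono (Adj? G u v) (Adj? G v u) (symm G))

      column : ∀ u → sum (λ v → inward v u) ≡ k̄ u * deg G u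
      column u = trans (sum-cong-≗ (λ v → cong (k̄ u *_) (adj-sym u v))) (row u)

      -- Over abstract decisions the inequality is a finite table. E stands for u = v, which
      -- excludes adjacency and transfers membership in K from v to u.
      bound : ∀ {P Q A E : Set} (v∈ : Dec P) (u∈ : Dec Q) (vu : Dec A) (eq : Dec E) →
              ¬ (A × E) → (P → E → Q) →
              ⟦ vu ⟧ + ⟦ v∈ ⟧ * ⟦ eq ⟧
                ≤ ⟦ v∈ ⟧ * ⟦ u∈ ⟧ + (⟦ ¬? v∈ ⟧ * ⟦ vu ⟧ + ⟦ ¬? u∈ ⟧ * ⟦ vu ⟧)
      bound _       _       (yes a) (yes e) ¬ae _ = contradiction (a , e) ¬ae
      bound (yes _) (yes _) (yes _) (no _)  _   _ = s≤s z≤n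
      bound (yes _) (no _)  (yes _) (no _)  _   _ = s≤s z≤n
      bound (no _)  u∈      (yes _) (no _)  _   _ = s≤s z≤n
      bound (no _)  _       (no _)  _       _   _ = z≤n
      bound (yes _) _       (no _)  (no _)  _   _ = z≤n
      bound (yes p) u∈      (no _)  (yes e) _   f rewrite ⟦⟧-yes u∈ (f p e) = s≤s z≤n

      pointwise : ∀ v u → adj v u + k v * ⟦ u Fin.≟ v ⟧ ≤ within v u + (outward v u + inward v u)
      pointwise v u = bound (v ∈? K) (u ∈? K) (Adj? G v u) (u Fin.≟ v)
        (λ { (vv , refl) → irrefl G vv }) (λ { v∈K refl → v∈K })

-- Arithmetic

-- Replaces subtraction in polynomial inequalities: the ring solver writes both sides as c plus a
-- remainder, and c is cancelled.
cancel-common : ∀ {x y} c {x′ y′} → x ≡ c + x′ → y ≡ c + y′ → x ≤ y → x′ ≤ y′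
cancel-common c refl refl = +-cancelˡ-≤ c _ _

-- In the next two lemmas K has m vertices, there are a + x vertices outside it
-- and D is the sum of all degrees; N = m + x, and the inequality N² + … is the
-- lower bound on the number of edges. The hypothesis on n enters as n ≥ 6a + k,
-- that is, N = 5a + z + k.
large-clique-bound : ∀ m x a k D →
  (m + x) * (m + x) + 2 * (a * (a + k)) + 2 ≤ D + (m + x) + 2 * a →
  D + m + 2 * (a + x) ≤ m * m + 2 * ((a + x) * (a + x + k)) →
  ¬ (3 * x + 4 * a + 2 * k ≤ 2 * (m + x) + 1)
large-clique-bound m x a k D lower upper few = contradiction
  (≤-trans reduced (*-monoʳ-≤ x few′)) (m+1+n≰m (x * (2 * m + 1)))
  where
  -- Adding the two bounds eliminates D. Against `few′` the left side is too large by 2.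
  reduced : x * (2 * m + 1) + 2 ≤ x * (4 * a + x + 2 * k)
  reduced = cancel-common (D + m * m + x * x + 2 * (a * a) + 2 * (a * k) + m + 2 * a + x)
    (left m x a k D) (right m x a k D) (+-mono-≤ lower upper)
    where
    left : ∀ m x a k D →
      (m + x) * (m + x) + 2 * (a * (a + k)) + 2 + (D + m + 2 * (a + x)) ≡
      (D + m * m + x * x + 2 * (a * a) + 2 * (a * k) + m + 2 * a + x) + (x * (2 * m + 1) + 2)
    left = solve-∀
    right : ∀ m x a k D →
      D + (m + x) + 2 * a + (m * m + 2 * ((a + x) * (a + x + k))) ≡
      (D + m * m + x * x + 2 * (a * a) + 2 * (a * k) + m + 2 * a + x) + x * (4 * a + x + 2 * k)
    right = solve-∀
  few′ : 4 * a + x + 2 * k ≤ 2 * m + 1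
  few′ = cancel-common (2 * x) (left x a k) (right x m) few
    where
    left : ∀ x a k → 3 * x + 4 * a + 2 * k ≡ 2 * x + (4 * a + x + 2 * k)
    left = solve-∀
    right : ∀ x m → 2 * (m + x) + 1 ≡ 2 * x + (2 * m + 1)
    right = solve-∀

small-clique-bound : ∀ m x a k D p z → let N = 5 * a + z + k in
  m + x ≡ N → p + p ≡ a + N + k →
  N * N + 2 * (a * (a + k)) + 2 ≤ D + N + 2 * a →
  D + (a + N) ≤ m * (a + N) + (a + x) * p →
  3 * x + 4 * a + 2 * k ≤ 2 * N + 1
small-clique-bound m x a k D p z m+x≡N 2p lower upper = ≮⇒≥ λ many →
  contradiction (≤-trans (+-monoˡ-≤ 12 (*-monoˡ-≤ (6 * a + z) (many′ many))) tripled)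
    (λ le → m+1+n≰m _ (subst (_≤ 3 * (2 * a + 12 * (a * a) + 3 * (a * z))) (excess a z) le))
  where
  N = 5 * a + z + k

  -- Adding x(a + N) to both sides eliminates m, since m + x = N.
  upper′ : D + (a + N) + x * (a + N) ≤ N * (a + N) + (a + x) * p
  upper′ = begin
    D + (a + N) + x * (a + N)                 ≤⟨ +-monoˡ-≤ (x * (a + N)) upper ⟩
    m * (a + N) + (a + x) * p + x * (a + N)   ≡⟨ regroup m x (a + N) ((a + x) * p) ⟩
    (m + x) * (a + N) + (a + x) * p           ≡⟨ cong (λ s → s * (a + N) + (a + x) * p) m+x≡N ⟩
    N * (a + N) + (a + x) * p                 ∎
    where
    open ≤-Reasoning
    regroup : ∀ m x n r → m * n + r + x * n ≡ (m + x) * n + r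
    regroup = solve-∀

  -- The sum of `lower` and `upper′` is doubled so that p occurs only as p + p, which is a + N + k.
  reduced : x * (6 * a + z) + 4 ≤ 2 * a + 12 * (a * a) + 3 * (a * z)
  reduced = cancel-common
    (2 * (N * N) + 2 * D + 2 * N + x * (6 * a + z + 2 * k) + 2 * a + 4 * (a * a) + 4 * (a * k))
    (left a k z x D)
    (trans (split N D a x p)
      (trans (cong (λ s → 2 * (D + N + 2 * a) + 2 * (N * (a + N)) + (a + x) * s) 2p)
             (right a k z x D)))
    (*-monoʳ-≤ 2 (+-mono-≤ lower upper′))
    where
    left : ∀ a k z x D → let N = 5 * a + z + k in
      2 * (N * N + 2 * (a * (a + k)) + 2 + (D + (a + N) + x * (a + N))) ≡
      (2 * (N * N) + 2 * D + 2 * N + x * (6 * a + z + 2 * k) + 2 * a + 4 * (a * a) + 4 * (a * k))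
        + (x * (6 * a + z) + 4)
    left = solve-∀
    split : ∀ N D a x p → 2 * (D + N + 2 * a + (N * (a + N) + (a + x) * p)) ≡
                          2 * (D + N + 2 * a) + 2 * (N * (a + N)) + (a + x) * (p + p)
    split = solve-∀
    right : ∀ a k z x D → let N = 5 * a + z + k in
      2 * (D + N + 2 * a) + 2 * (N * (a + N)) + (a + x) * (a + N + k) ≡
      (2 * (N * N) + 2 * D + 2 * N + x * (6 * a + z + 2 * k) + 2 * a + 4 * (a * a) + 4 * (a * k))
        + (2 * a + 12 * (a * a) + 3 * (a * z))
    right = solve-∀

  tripled : 3 * x * (6 * a + z) + 12 ≤ 3 * (2 * a + 12 * (a * a) + 3 * (a * z))
  tripled = subst (_≤ 3 * (2 * a + 12 * (a * a) + 3 * (a * z)))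
    (triple x (6 * a + z)) (*-monoʳ-≤ 3 reduced)
    where
    triple : ∀ x y → 3 * (x * y + 4) ≡ 3 * x * y + 12
    triple = solve-∀

  many′ : 2 * N + 1 < 3 * x + 4 * a + 2 * k → 6 * a + 2 * z + 2 ≤ 3 * x
  many′ = cancel-common (4 * a + 2 * k) (left a k z) (right a k x)
    where
    left : ∀ a k z → suc (2 * (5 * a + z + k) + 1) ≡ 4 * a + 2 * k + (6 * a + 2 * z + 2)
    left = solve-∀
    right : ∀ a k x → 3 * x + 4 * a + 2 * k ≡ 4 * a + 2 * k + 3 * x
    right = solve-∀

  -- Putting the lower bound for 3x from `many′` into `tripled` makes its left side larger than its
  -- right by a positive polynomial.
  excess : ∀ a z → (6 * a + 2 * z + 2) * (6 * a + z) + 12 ≡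
    3 * (2 * a + 12 * (a * a) + 3 * (a * z)) + suc (6 * a + 9 * (a * z) + 2 * (z * z) + 2 * z + 11)
  excess = solve-∀

2*nC2+n≡n² : ∀ n → n C 2 + n C 2 + n ≡ n * n
2*nC2+n≡n² zero    = refl
2*nC2+n≡n² (suc n) rewrite sym (nCk+nC[k+1]≡[n+1]C[k+1] n 1) | nC1≡n n =
  trans (regroup n (n C 2)) (trans (cong (λ s → s + n + n + 1) (2*nC2+n≡n² n)) (square n))
  where
  regroup : ∀ n c → n + c + (n + c) + suc n ≡ c + c + n + n + n + 1
  regroup = solve-∀
  square : ∀ n → n * n + n + n + 1 ≡ suc n * suc n
  square = solve-∀

-- Structure of the closure

Complete : Graph (Fin n) → Set
Complete G = ∀ {u v} → u ≢ v → Adj G u v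

module Structure (G : Graph (Fin n)) (δ k : ℕ)
  (connected : ((δ + k) -Connected) G)
  (sparse : ∀ {u v} → u ≢ v → ¬ Adj G u v → deg G u + deg G v + 2 ≤ n + k)
  (K° : Subset n) (K-clique : IsClique G K°) (K-maximal : IsMaximal G K°)
  where

  private
    m = ∣ K° ∣
    t = δ + k

  -- Some c in the clique is missed by w; it has degree at least m - 1, and sparseness bounds the
  -- degree sum of w and c.
  outer-degree : ∀ {w} → w ∉ K° → deg G w + m + 1 ≤ n + k
  outer-degree {w} w∉K with (c , c∈K , ¬wc) ← K-maximal w∉K = begin
    deg G w + m + 1              ≤⟨ +-monoˡ-≤ 1 (+-monoʳ-≤ (deg G w) (clique-size-≤ G K-clique c∈K)) ⟩
    deg G w + (deg G c + 1) + 1  ≡⟨ regroup (deg G w) (deg G c) ⟩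
    deg G w + deg G c + 2        ≤⟨ sparse (λ { refl → w∉K c∈K }) ¬wc ⟩
    n + k                        ∎
    where
    open ≤-Reasoning
    regroup : ∀ x y → x + (y + 1) + 1 ≡ x + y + 2
    regroup = solve-∀

  many-outside : ∀ {w} → w ∉ K° → suc δ ≤ ∁size K°
  many-outside {w} w∉K = cancel-common (m + k) (left δ k m) (right m (∁size K°) k) (begin
    δ + k + m + 1       ≤⟨ +-monoˡ-≤ 1 (+-monoˡ-≤ m (min-degree G connected w)) ⟩
    deg G w + m + 1     ≤⟨ outer-degree w∉K ⟩
    n + k               ≡⟨ cong (_+ k) (size+∁size K°) ⟨
    m + ∁size K° + k    ∎)
    where
    open ≤-Reasoning
    left : ∀ δ k m → δ + k + m + 1 ≡ m + k + suc δ
    left = solve-∀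
    right : ∀ m q k → m + q + k ≡ m + k + q
    right = solve-∀

  module _ (q≡ : ∁size K° ≡ suc δ) {w₀ : Fin n} (w₀∉K : w₀ ∉ K°) where
    private
      n+k≡ : n + k ≡ t + m + 1
      n+k≡ = trans (cong (_+ k) (trans (sym (size+∁size K°)) (cong (m +_) q≡))) (regroup m δ k)
        where
        regroup : ∀ m δ k → m + suc δ + k ≡ δ + k + m + 1
        regroup = solve-∀

      -- Since n + k = t + m + 1, this is `outer-degree`; with `min-degree` it forces every outer
      -- degree to be exactly t.
      deg≤t : ∀ {w} → w ∉ K° → deg G w ≤ t
      deg≤t {w} w∉K = +-cancelʳ-≤ m _ _
        (+-cancelʳ-≤ 1 _ _ (≤-trans (outer-degree w∉K) (≤-reflexive n+k≡)))

      -- A vertex of K° with a neighbour outside K° has degree at least m, so by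
      -- sparseness it is joined to everything outside K°.
      attached : ∀ {c w x} → c ∈ K° → w ∉ K° → x ∉ K° → Adj G c x → Adj G w c
      attached {c} {w} c∈K w∉K x∉K cx = decidable-stable (Adj? G w c) λ ¬wc →
        m+1+n≰m (t + m + 1) (begin
          t + m + 1 + 1           ≡⟨ +-assoc (t + m) 1 1 ⟩
          t + m + 2               ≤⟨ +-monoˡ-≤ 2 (+-mono-≤ (min-degree G connected w)
                                       (clique-size-≤-deg G K-clique c∈K x∉K cx)) ⟩
          deg G w + deg G c + 2   ≤⟨ sparse (λ { refl → w∉K c∈K }) ¬wc ⟩
          n + k                   ≡⟨ n+k≡ ⟩
          t + m + 1               ∎)
        where open ≤-Reasoning

      -- By `attached` the neighbours of `w₀` in the clique are those of every outer vertex, so the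
      -- choice of `w₀` does not affect T.
      T? : Decidable (λ c → c ∈ K° × Adj G w₀ c)
      T? c = (c ∈? K°) ×-dec Adj? G w₀ c

      T : Subset n
      T = ⟪ T? ⟫

      T⊆K : ∀ {c} → c ∈ T → c ∈ K°
      T⊆K = proj₁ ∘ ∈-⟪⟫⁻ T?

      outer-T : ∀ {w c} → w ∉ K° → c ∈ T → Adj G w c
      outer-T w∉K c∈T = let (c∈K , w₀c) = ∈-⟪⟫⁻ T? c∈T in attached c∈K w∉K w₀∉K (symm G w₀c)

      outer-K : ∀ {w c} → w ∉ K° → c ∈ K° → Adj G w c → c ∈ T
      outer-K w∉K c∈K wc = ∈-⟪⟫⁺ T? (c∈K , attached c∈K w₀∉K w∉K (symm G wc))

      -- Deleting T cuts the outer vertices off from the rest of the clique, and this rest contains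
      -- the vertex that `w₀` misses.
      t≤∣T∣ : t ≤ ∣ T ∣
      t≤∣T∣ with (c , c∈K , ¬w₀c) ← K-maximal w₀∉K =
        separator-size G connected T (_∉ K°) (λ u∉K x∉T ux x∈K → x∉T (outer-K u∉K x∈K ux))
          (w₀∉K ∘ T⊆K) w₀∉K (¬w₀c ∘ proj₂ ∘ ∈-⟪⟫⁻ T?) (λ c∉K → c∉K c∈K)

      -- T already supplies t neighbours of w, and the degree of w is at most t.
      outer-neighbours : ∀ {w x} → w ∉ K° → Adj G w x → x ∈ T
      outer-neighbours {w} {x} w∉K wx = decidable-stable (x ∈? T) λ x∉T →
        <⇒≱ (∣S∣<deg G T (outer-T w∉K) x∉T wx) (≤-trans (deg≤t w∉K) t≤∣T∣)

      ∣T∣≡t : ∣ T ∣ ≡ t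
      ∣T∣≡t = ≤-antisym (≤-trans ∣T∣≤deg (deg≤t w₀∉K)) t≤∣T∣
        where
        ∣T∣≤deg : ∣ T ∣ ≤ deg G w₀
        ∣T∣≤deg = subst₂ _≤_ (sum-∈ T) (sym (deg-sum G w₀))
          (sum-mono λ u → ⟦⟧-mono (u ∈? T) (Adj? G w₀ u) (outer-T w₀∉K))

      part : ∀ {P Q : Set} → Dec P → Dec Q → Part
      part (yes _) _       = joint
      part (no _)  (yes _) = clique
      part (no _)  (no _)  = single

      f : Fin n → Part
      f v = part (v ∈? T) (v ∈? K°)

      open Classes _≟ᴾ_ using (size)

      size-joint : size f joint ≡ t
      size-joint = trans (sum-cong-≗ (λ v → pointwise (v ∈? T) (v ∈? K°))) (trans (sum-∈ T) ∣T∣≡t)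
        where
        pointwise : ∀ {P Q : Set} (d : Dec P) (d′ : Dec Q) → ⟦ part d d′ ≟ᴾ joint ⟧ ≡ ⟦ d ⟧
        pointwise (yes _) _       = refl
        pointwise (no _)  (yes _) = refl
        pointwise (no _)  (no _)  = refl

      size-single : size f single ≡ suc δ
      size-single = trans (sum-cong-≗ (λ v → pointwise T⊆K (v ∈? T) (v ∈? K°))) q≡
        where
        pointwise : ∀ {P Q : Set} → (P → Q) → (d : Dec P) (d′ : Dec Q) →
                    ⟦ part d d′ ≟ᴾ single ⟧ ≡ ⟦ ¬? d′ ⟧
        pointwise f (yes p) (no ¬q) = contradiction (f p) ¬q
        pointwise f (yes _) (yes _) = refl
        pointwise f (no _)  (yes _) = refl
        pointwise f (no _)  (no _)  = refl

      sizes : size f joint + size f clique + size f single ≡ n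
      sizes = begin
        size f joint + size f clique + size f single
          ≡⟨ cong (_+ size f single) (∑-distrib-+ (is joint) (is clique)) ⟨
        sum (λ v → is joint v + is clique v) + size f single
          ≡⟨ ∑-distrib-+ (λ v → is joint v + is clique v) (is single) ⟨
        sum (λ v → is joint v + is clique v + is single v)
          ≡⟨ sum-cong-≗ (one ∘ f) ⟩
        sum {n} (λ _ → 1)
          ≡⟨ trans (sum-const n 1) (*-identityʳ n) ⟩
        n ∎
        where
        open ≡-Reasoning
        is : Part → Fin n → ℕ
        is c v = ⟦ f v ≟ᴾ c ⟧
        one : ∀ x → ⟦ x ≟ᴾ joint ⟧ + ⟦ x ≟ᴾ clique ⟧ + ⟦ x ≟ᴾ single ⟧ ≡ 1
        one joint  = refl
        one clique = refl
        one single = refl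

      -- The part sizes t, s and δ + 1 add up to n; adding k gives n + k = s + (2t + 1).
      size-clique : size f clique ≡ n + k ∸ 2 * t ∸ 1
      size-clique = sym (trans (∸-+-assoc (n + k) (2 * t) 1)
        (trans (cong (_∸ (2 * t + 1)) n+k≡′) (m+n∸n≡m (size f clique) (2 * t + 1))))
        where
        regroup : ∀ s δ k → δ + k + s + suc δ + k ≡ s + (2 * (δ + k) + 1)
        regroup = solve-∀
        n+k≡′ : n + k ≡ size f clique + (2 * t + 1)
        n+k≡′ = trans (cong (_+ k) (trans (sym sizes)
                        (cong₂ (λ x y → x + size f clique + y) size-joint size-single)))
                      (regroup (size f clique) δ k)

      linked : ∀ u v → Adj G u v ⇔ (u ≢ v × Linked (f u) (f v))
      linked u v = cases (u ∈? T) (u ∈? K°) (v ∈? T) (v ∈? K°)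
        where
        together : (u ≢ v → Adj G u v) → Adj G u v ⇔ (u ≢ v × ⊤)
        together uv = mk⇔ (λ uv → (λ { refl → irrefl G uv }) , tt) (uv ∘ proj₁)

        apart : ¬ Adj G u v → Adj G u v ⇔ (u ≢ v × ⊥)
        apart ¬uv = mk⇔ (λ uv → contradiction uv ¬uv) λ ()

        cases : (uT : Dec (u ∈ T)) (uK : Dec (u ∈ K°)) (vT : Dec (v ∈ T)) (vK : Dec (v ∈ K°)) →
                Adj G u v ⇔ (u ≢ v × Linked (part uT uK) (part vT vK))
        cases (yes u∈T) _         (yes v∈T) _         = together (K-clique (T⊆K u∈T) (T⊆K v∈T))
        cases (yes u∈T) _         (no _)    (yes v∈K) = together (K-clique (T⊆K u∈T) v∈K)
        cases (yes u∈T) _         (no _)    (no v∉K)  = together (λ _ → symm G (outer-T v∉K u∈T))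
        cases (no _)    (yes u∈K) (yes v∈T) _         = together (K-clique u∈K (T⊆K v∈T))
        cases (no _)    (yes u∈K) (no _)    (yes v∈K) = together (K-clique u∈K v∈K)
        cases (no u∉T)  (yes _)   (no _)    (no v∉K)  = apart (u∉T ∘ outer-neighbours v∉K ∘ symm G)
        cases (no _)    (no u∉K)  (yes v∈T) _         = together (λ _ → outer-T u∉K v∈T)
        cases (no _)    (no u∉K)  (no v∉T)  (yes _)   = apart (v∉T ∘ outer-neighbours u∉K)
        cases (no _)    (no u∉K)  (no v∉T)  (no _)    = apart (v∉T ∘ outer-neighbours u∉K)

    is-extremal : G ≅ (K t ∨ (K (n + k ∸ 2 * t ∸ 1) ⊕ ((t ∸ k + 1) · K 1)))
    is-extremal = extremal-≅ G f linked size-joint size-clique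
      (trans size-single (trans (+-comm 1 δ) (cong (_+ 1) (sym (m+n∸n≡m δ k)))))

-- Edge counts force a complete or extremal closure

module _ (G : Graph (Fin n)) (δ k z p : ℕ)
  (n≡ : n ≡ 2 + δ + (5 * (2 + δ) + z + k)) (2p≡ : p + p ≡ n + k)
  (connected : ((δ + k) -Connected) G)
  (sparse : ∀ {u v} → u ≢ v → ¬ Adj G u v → deg G u + deg G v + 2 ≤ n + k)
  where

  private
    -- With t = δ + k, `a` is t - k + 2 and `N` is n + k - t - 2, as in the edge bound; `z` is the
    -- slack in n ≥ 6a + k, and `p` is (n + k)/2.
    a = 2 + δ
    N = 5 * a + z + k
    t = δ + k

    high? : Decidable (λ v → p ≤ deg G v)
    high? v = p ≤? deg G v

    -- Two non-adjacent vertices of degree at least p would have degree sum at least n + k, which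
    -- sparseness forbids.
    high-clique : IsClique G ⟪ high? ⟫
    high-clique {u} {v} u∈ v∈ u≢v = decidable-stable (Adj? G u v) λ ¬uv →
      m+1+n≰m (p + p) (begin
        p + p + 2               ≤⟨ +-monoˡ-≤ 2 (+-mono-≤ (∈-⟪⟫⁻ high? u∈) (∈-⟪⟫⁻ high? v∈)) ⟩
        deg G u + deg G v + 2   ≤⟨ sparse u≢v ¬uv ⟩
        n + k                   ≡⟨ 2p≡ ⟨
        p + p                   ∎)
      where open ≤-Reasoning

  complete-or-extremal : N * N + 2 * (a * (a + k)) + 2 ≤ sum (deg G) + N + 2 * a →
    Complete G ⊎
    (G ≅ (K t ∨ (K (n + k ∸ 2 * t ∸ 1) ⊕ ((t ∸ k + 1) · K 1))))
  complete-or-extremal many-edges with maximal-clique G ⟪ high? ⟫ high-clique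
  ... | K° , high⊆K , K-clique , K-maximal with Fin.any? (λ w → ¬? (w ∈? K°))
  ...   | no none = inj₁ (K-clique (all∈K _) (all∈K _))
    where
    all∈K : ∀ v → v ∈ K°
    all∈K v = decidable-stable (v ∈? K°) λ v∉K → none (v , v∉K)
  ...   | yes (w , w∉K) = inj₂ (is-extremal (≤-antisym (≮⇒≥ few-outside) (many-outside w∉K)) w∉K)
    where
    open Structure G δ k connected sparse K° K-clique K-maximal
    m = ∣ K° ∣
    q = ∁size K°

    -- Write q = a + x. Outer degrees below (n + k)/2 give `upper′`, which limits x; under this
    -- limit `upper`, from outer degrees at most n + k - m - 1, contradicts the number of edges.
    few-outside : ¬ (a ≤ q)
    few-outside a≤q with (x , q≡) ← m≤n⇒∃[o]m+o≡n a≤q =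
      large-clique-bound m x a k (sum (deg G))
        (subst (λ N → N * N + 2 * (a * (a + k)) + 2 ≤ sum (deg G) + N + 2 * a) (sym m+x≡N)
          many-edges)
        upper
        (subst (λ N → 3 * x + 4 * a + 2 * k ≤ 2 * N + 1) (sym m+x≡N)
          (small-clique-bound m x a k (sum (deg G)) p z m+x≡N
            (trans 2p≡ (cong (_+ k) n≡)) many-edges upper′))
      where
      n≡m+q : n ≡ m + (a + x)
      n≡m+q = trans (sym (size+∁size K°)) (cong (m +_) (sym q≡))

      m+x≡N : m + x ≡ N
      m+x≡N = +-cancelˡ-≡ a _ _ (trans (regroup a m x) (trans (sym n≡m+q) n≡))
        where
        regroup : ∀ a m x → a + (m + x) ≡ m + (a + x)
        regroup = solve-∀

      outer-bound : ∀ {v} → v ∉ K° → deg G v + 1 ≤ a + x + k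
      outer-bound {v} v∉K = cancel-common m (left (deg G v) m)
        (trans (cong (_+ k) n≡m+q) (+-assoc m (a + x) k)) (outer-degree v∉K)
        where
        left : ∀ d m → d + m + 1 ≡ m + (d + 1)
        left = solve-∀

      outer-sum : sum (λ v → ⟦ ¬? (v ∈? K°) ⟧ * deg G v) + (a + x) ≤ (a + x) * (a + x + k)
      outer-sum = begin
        sum (λ v → ⟦ ¬? (v ∈? K°) ⟧ * deg G v) + (a + x)
          ≡⟨ cong (sum (λ v → ⟦ ¬? (v ∈? K°) ⟧ * deg G v) +_) q≡ ⟩
        sum (λ v → ⟦ ¬? (v ∈? K°) ⟧ * deg G v) + q
          ≡⟨ ∑-distrib-+ (λ v → ⟦ ¬? (v ∈? K°) ⟧ * deg G v) (λ v → ⟦ ¬? (v ∈? K°) ⟧) ⟨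
        sum (λ v → ⟦ ¬? (v ∈? K°) ⟧ * deg G v + ⟦ ¬? (v ∈? K°) ⟧)
          ≡⟨ sum-cong-≗ (λ v → factor ⟦ ¬? (v ∈? K°) ⟧ (deg G v)) ⟩
        sum (λ v → ⟦ ¬? (v ∈? K°) ⟧ * (deg G v + 1))
          ≤⟨ sum-∁-bound K° (λ v → deg G v + 1) (a + x + k) outer-bound ⟩
        q * (a + x + k)
          ≡⟨ cong (_* (a + x + k)) q≡ ⟨
        (a + x) * (a + x + k) ∎
        where
        open ≤-Reasoning
        factor : ∀ b d → b * d + b ≡ b * (d + 1)
        factor = solve-∀

      upper : sum (deg G) + m + 2 * (a + x) ≤ m * m + 2 * ((a + x) * (a + x + k))
      upper = begin
        sum (deg G) + m + 2 * (a + x)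
          ≤⟨ +-monoˡ-≤ (2 * (a + x)) (degree-sum-bound K° G) ⟩
        m * m + 2 * sum (λ v → ⟦ ¬? (v ∈? K°) ⟧ * deg G v) + 2 * (a + x)
          ≡⟨ regroup (m * m) (sum (λ v → ⟦ ¬? (v ∈? K°) ⟧ * deg G v)) (a + x) ⟩
        m * m + 2 * (sum (λ v → ⟦ ¬? (v ∈? K°) ⟧ * deg G v) + (a + x))
          ≤⟨ +-monoʳ-≤ (m * m) (*-monoʳ-≤ 2 outer-sum) ⟩
        m * m + 2 * ((a + x) * (a + x + k)) ∎
        where
        open ≤-Reasoning
        regroup : ∀ M s q → M + 2 * s + 2 * q ≡ M + 2 * (s + q)
        regroup = solve-∀

      upper′ : sum (deg G) + (a + N) ≤ m * (a + N) + (a + x) * p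
      upper′ = subst₂ _≤_ left (cong₂ (λ r s → m * r + s * p) n≡ (sym q≡))
        -- Here deg v + 1 is at most n for every v, and at most p outside the clique, which contains
        -- all vertices of degree at least p.
        (sum-split-bound K° (λ v → deg G v + 1) n p
          (λ v → subst (_≤ n) (+-comm 1 (deg G v)) (deg<n G v))
          (λ {v} v∉K → subst (_≤ p) (+-comm 1 (deg G v)) (≰⇒> (v∉K ∘ high⊆K ∘ ∈-⟪⟫⁺ high?))))
        where
        left : sum (λ v → deg G v + 1) ≡ sum (deg G) + (a + N)
        left = trans (∑-distrib-+ (deg G) (λ _ → 1))
          (cong (sum (deg G) +_) (trans (sum-const n 1) (trans (*-identityʳ n) n≡)))

-- Parity, and passage between a graph and its closure

same-parity : ∀ {k n} → k ≤ n → n % 2 ≡ k % 2 → ∃ λ h → n ≡ h + h + k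
-- Equal remainders leave only the quotients to differ: h is n / 2 - k / 2.
same-parity {k} {n} k≤n eq with (h , k/2+h≡) ← m≤n⇒∃[o]m+o≡n (/-monoˡ-≤ 2 k≤n) = h , (begin
  n                            ≡⟨ m≡m%n+[m/n]*n n 2 ⟩
  n % 2 + n / 2 * 2            ≡⟨ cong₂ (λ r s → r + s * 2) eq (sym k/2+h≡) ⟩
  k % 2 + (k / 2 + h) * 2      ≡⟨ regroup (k % 2) (k / 2) h ⟩
  h + h + (k % 2 + k / 2 * 2)  ≡⟨ cong (h + h +_) (m≡m%n+[m/n]*n k 2) ⟨
  h + h + k                    ∎)
  where
  open ≡-Reasoning
  regroup : ∀ r s h → r + (s + h) * 2 ≡ h + h + (r + s * 2)
  regroup = solve-∀

theorem1p7 : ∀ (t k n : ℕ) → t ≥ k → k ≥ 1 →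
    (G : Graph (Fin n)) → (t -Connected) G →
    2 * n + 11 * k ≥ 15 * t + 29 →
    n % 2 ≡ k % 2 →
    e G > (n + k ∸ t ∸ 2) C 2 + (t ∸ k + 2) * (t + 1) →
    ¬ (𝒞 (n + k ∸ 1) G ≅ (K t ∨ (K (n + k ∸ 2 * t ∸ 1) ⊕ ((t ∸ k + 1) · K 1)))) →
    (k -FactorCritical) G
theorem1p7 t k n k≤t 1≤k G connected large parity edges not-extremal
  -- From here on t is δ + k, with δ = t - k.
  with (δ , refl) ← (∃ λ δ → δ + k ≡ t) ∋ (t ∸ k , m∸n+n≡m k≤t) =
  let a = 2 + δ
      (z , 6a+k+z≡n) = m≤n⇒∃[o]m+o≡n (large-order δ k n large)
      N = 5 * a + z + k
      n≡ : n ≡ a + N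
      n≡ = trans (sym 6a+k+z≡n) (order a k z)
      (h , n≡2h+k) = same-parity
        (≤-trans (m≤n+m k (6 * a)) (≤-trans (m≤m+n _ z) (≤-reflexive 6a+k+z≡n))) parity
      H = 𝒞 (n + k ∸ 1) G
      (steps , closed) = 𝒞-isClosure (n + k ∸ 1) G
      G⊆H : G ⊆ᴳ H
      G⊆H = steps-⊆ steps
      n+k≤ = m≤n+m∸n (n + k) 1
      sparse : ∀ {u v} → u ≢ v → ¬ Adj H u v → deg H u + deg H v + 2 ≤ n + k
      sparse {u} {v} u≢v ¬uv = subst (_≤ n + k) (sym (+-suc (deg H u + deg H v) 1))
        -- A closed graph has deg u + deg v < n + k - 1 here; the truncated subtraction is undone by
        -- means of 1 ≤ n + k.
        (m≤o∸n⇒m+n≤o _ (≤-trans 1≤k (m≤n+m k n)) (≰⇒> λ le → closed u v (u≢v , ¬uv , le)))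
      -- Edges are counted in G and degrees in H, where they can only be larger.
      many-edges = ≤-trans (edge-count N δ k (e G)
          (subst (λ s → s C 2 + (δ + k ∸ k + 2) * (δ + k + 1) < e G) (clique-order n δ k z n≡) edges))
        (+-monoˡ-≤ (2 * a) (+-monoˡ-≤ N (≤-trans (handshake G) (sum-mono (deg-mono G H G⊆H)))))
      complete : Complete H
      complete = Sum.fromInj₁ (λ iso → contradiction iso not-extremal)
        -- From n = 2h + k, half of n + k is h + k.
        (complete-or-extremal H δ k z (h + k) n≡ (trans (twice h k) (cong (_+ k) (sym n≡2h+k)))
          (connected-mono {G = G} {H} G⊆H connected) sparse many-edges)
  -- The complete closure has a perfect matching off S, which is carried back to G one join at a
  -- time.
  in λ { S refl → perfect (unsteps n+k≤ steps (complete-matching H complete S h n≡2h+k)) }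
  where
  -- In terms of δ the order hypothesis is 2n ≥ 15δ + 4k + 29, and the right side is 2(6(2 + δ) + k)
  -- plus 3δ + 2k + 5.
  large-order : ∀ δ k n → 15 * (δ + k) + 29 ≤ 2 * n + 11 * k → 6 * (2 + δ) + k ≤ n
  large-order δ k n large = *-cancelˡ-≤ 2 (≤-trans (m≤m+n _ (3 * δ + 2 * k + 5))
    (cancel-common (11 * k) (left δ k) (+-comm (2 * n) (11 * k)) large))
    where
    left : ∀ δ k → 15 * (δ + k) + 29 ≡ 11 * k + (2 * (6 * (2 + δ) + k) + (3 * δ + 2 * k + 5))
    left = solve-∀

  order : ∀ a k z → 6 * a + k + z ≡ a + (5 * a + z + k)
  order = solve-∀

  twice : ∀ h k → h + k + (h + k) ≡ h + h + k + k
  twice = solve-∀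

  clique-order : ∀ n δ k z → n ≡ 2 + δ + (5 * (2 + δ) + z + k) →
                 n + k ∸ (δ + k) ∸ 2 ≡ 5 * (2 + δ) + z + k
  clique-order n δ k z n≡ = trans (∸-+-assoc (n + k) (δ + k) 2)
    (trans (cong (_∸ (δ + k + 2)) (trans (cong (_+ k) n≡) (regroup δ k (5 * (2 + δ) + z + k))))
      (m+n∸n≡m _ (δ + k + 2)))
    where
    regroup : ∀ δ k N → 2 + δ + N + k ≡ N + (δ + k + 2)
    regroup = solve-∀

  -- Doubling clears the binomial coefficient, as twice it plus N is N². The final 2 on the left
  -- reflects strictness; the term 2(2 + δ) on the right pays for replacing δ + k + 1 by 2 + δ + k.
  edge-count : ∀ N δ k E → N C 2 + (δ + k ∸ k + 2) * (δ + k + 1) < E →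
    N * N + 2 * ((2 + δ) * (2 + δ + k)) + 2 ≤ E + E + N + 2 * (2 + δ)
  edge-count N δ k E bound rewrite m+n∸n≡m δ k | sym (2*nC2+n≡n² N) =
    subst₂ _≤_ (left (N C 2) N δ k) (right E N δ) (+-monoˡ-≤ (N + 2 * (2 + δ)) (*-monoʳ-≤ 2 bound))
    where
    left : ∀ c N δ k → 2 * suc (c + (δ + 2) * (δ + k + 1)) + (N + 2 * (2 + δ)) ≡
      c + c + N + 2 * ((2 + δ) * (2 + δ + k)) + 2
    left = solve-∀
    right : ∀ E N δ → 2 * E + (N + 2 * (2 + δ)) ≡ E + E + N + 2 * (2 + δ)
    right = solve-∀
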